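{- Let $\Sigma$ be a signed alphabet. Let $\mathrm{Col}_3(\Sigma)$ be the extended presentation obtained from the rewriting system $\mathrm{Col}_2(\Sigma)$ by adjoining one 3-cell $\mathcal{X}_{u,v,t}$ for every triple $u,v,t$ of nonempty super columns such that neither $(u,v)$ nor $(v,t)$ is juxtaposable. The 3-cell $\mathcal{X}_{u,v,t}$ goes from the 2-cell $$(\gamma_{u,v}c_t)\star_1(c_e\gamma_{e',t})\star_1(\gamma_{e,b}c_{b'}):\ c_uc_vc_t\Rightarrow c_ec_{e'}c_t\Rightarrow c_ec_bc_{b'}\Rightarrow c_ac_dc_{b'}$$ to the 2-cell $$(c_u\gamma_{v,t})\star_1(\gamma_{u,w}c_{w'})\star_1(c_a\gamma_{a',w'}):\ c_uc_vc_t\Rightarrow c_uc_wc_{w'}\Rightarrow c_ac_{a'}c_{w'}\Rightarrow c_ac_dc_{b'}.$$ The columns appearing here are as follows: - $e,e'$ are the column readings of $[uv]_r$; - $w,w'$ are the column readings of $[vt]_r$; - $a,a'$ are the column readings of $[uw]_r$; - $b,b'$ are the column readings of $[e't]_r$; - $a,d,b'$ are the readings of the three columns of $[uvt]_r$. Any of these columns may be empty, in which case $c_{\text{empty}}$ is the empty word; any indicated step $\gamma_{p,q}$ with $p$ or $q$ empty, or with $(p,q)$ juxtaposable, is an identity. Then $\mathrm{Col}_3(\Sigma)$ is a coherent presentation of the super plactic monoid $\mathbf{P}(\Sigma)$.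
   Context: A signed alphabet is a finite or countable totally ordered set $\Sigma$ with $\|\cdot\|:\Sigma\to\mathbb{Z}_2$; $\Sigma_0=\|\cdot\|^{ -1}(0)$, $\Sigma_1=\|\cdot\|^{ -1}(1)$. A super column is a word $x_1\ldots x_k$ over $\Sigma$ with $x_{i+1}\le x_i$, where equality is allowed only if $\|x_i\|=1$. A super tableau is a filling $T$ of a Young diagram by elements of $\Sigma$ such that: - $T(i,j)\le T(i,j+1)$, with equality only if $\|T(i,j)\|=0$; - $T(i,j)\le T(i+1,j)$, with equality only if $\|T(i,j)\|=1$. Column readings list the entries bottom to top, and the columns of a tableau are listed left to right. Right insertion $t\leftarrow x$ works as follows. - If $x\in\Sigma_0$ (resp. $\Sigma_1$) is $\ge$ (resp. $>$) the last entry of the top row, append it to that row. - Otherwise, $x$ replaces the smallest entry $y$ of the top row with $y>x$ (resp. $y\ge x$), and $y$ is inserted likewise into the next row (a new row if none). $[w]_r$ is obtained by inserting the letters of $w$ left to right into the empty tableau. Super columns $u=x_1\ldots x_p$, $v=y_1\ldots y_q$ are called juxtaposable if $p\ge q$ and $x_i\le y_i$ for all $i\le q$, with $x_i=y_i$ only if $\|x_i\|=0$ (i.e. the topmost juxtaposition of $[u]_r$, $[v]_r$ is a super tableau). $\mathrm{Col}_2(\Sigma)$ is the rewriting system on generators $c_u$ ($u$ a nonempty super column) with rules $\gamma_{u,v}:c_uc_v\Rightarrow c_wc_{w'}$ for each non-juxtaposable pair $(u,v)$. Here $w,w'$ are the readings of the left and right columns of $[uv]_r$ if it has two columns; otherwise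 $w=uv$ and $c_{w'}$ is empty. $\mathbf{P}(\Sigma)$ is $\Sigma^*$ modulo the congruence generated by the following relations: - $zxy=xzy$ for $x\le y\le z$, with $x=y$ only if $\|y\|=0$ and $y=z$ only if $\|y\|=1$; - $yzx=yxz$ for $x\le y\le z$, with $x=y$ only if $\|y\|=1$ and $y=z$ only if $\|y\|=0$. Given a rewriting system (2-polygraph) $\Sigma_2$ presenting a monoid $\mathbf{M}$, let $\Sigma_2^\top$ be the free $(2,1)$-category it generates: its 2-cells are composites of rewriting steps and their formal inverses. An extended presentation is such a $\Sigma_2$ together with a set $\Sigma_3$ of 3-cells, each relating two parallel 2-cells of $\Sigma_2^\top$. It is a coherent presentation of $\mathbf{M}$ if $\Sigma_3$ is a homotopy basis: for every pair of parallel 2-cells $f,g$ of $\Sigma_2^\top$ (same source and same target), there is a 3-cell from $f$ to $g$ in the free $(3,1)$-category generated by $(\Sigma_2,\Sigma_3)$. -}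

module Defs where

open import Level using (0ℓ)
open import Data.Bool using (Bool; true; false; _∧_; _∨_; not; T; if_then_else_)
open import Data.Bool.Properties using (T?)
open import Data.Nat using (ℕ; zero; suc; _≤ᵇ_)
open import Data.List using (List; []; _∷_; _++_; [_]; reverse; foldl; length; null; concatMap)
open import Data.Maybe using (Maybe; just; nothing)
open import Data.Product using (Σ; _×_; _,_; ∃)
open import Data.Sum using (_⊎_)
open import Function.Definitions using (Injective)
open import Relation.Nullary using (yes; no; ¬_)
open import Relation.Binary using (Rel; IsStrictTotalOrder; tri<; tri≈; tri>)
open import Relation.Binary.PropositionalEquality using (_≡_)
open import Relation.Binary.Construct.Closure.Equivalence using (EqClosure)

-- Signed alphabets: a countable (injects into ℕ) totally ordered set
-- with a sign map ∥_∥ : Σ → ℤ₂, encoded as Bool (false = 0, true = 1).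

record SignedAlphabet : Set₁ where
  field
    Carrier : Set
    _<_     : Rel Carrier 0ℓ
    isSTO   : IsStrictTotalOrder _≡_ _<_
    enc     : Carrier → ℕ
    enc-inj : Injective _≡_ _≡_ enc
    ∥_∥     : Carrier → Bool

module Super (S : SignedAlphabet) where
  open SignedAlphabet S
  open IsStrictTotalOrder isSTO using (compare)

  A : Set
  A = Carrier

  _≤_ : A → A → Set
  x ≤ y = (x < y) ⊎ (x ≡ y)

  ltb : A → A → Bool
  ltb x y with compare x y
  ... | tri< _ _ _ = true
  ... | tri≈ _ _ _ = false
  ... | tri> _ _ _ = false

  eqb : A → A → Bool
  eqb x y with compare x y
  ... | tri< _ _ _ = false
  ... | tri≈ _ _ _ = true
  ... | tri> _ _ _ = false

  leb : A → A → Bool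
  leb x y = ltb x y ∨ eqb x y

  -- Super columns (words x₁…x_k, read bottom to top):
  -- x_{i+1} ≤ x_i, with equality only if ∥x_i∥ = 1.

  isSuperColumn : List A → Bool
  isSuperColumn []             = true
  isSuperColumn (x ∷ [])       = true
  isSuperColumn (x ∷ y ∷ rest) =
    (ltb y x ∨ (eqb y x ∧ ∥ x ∥)) ∧ isSuperColumn (y ∷ rest)

  record Col : Set where
    constructor mkCol
    field
      word  : List A
      valid : T (isSuperColumn word ∧ not (null word))
  open Col public

  flat : List Col → List A
  flat = concatMap word

  -- a possibly empty column as a word of length ≤ 1 over generators
  -- (c_empty is the empty word)
  toCols : List A → List Col
  toCols w with T? (isSuperColumn w ∧ not (null w))
  ... | yes p = [ mkCol w p ]
  ... | no  _ = []

  -- Super tableaux as lists of rows, top row first; right insertion.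

  bumps : A → A → Bool
  bumps x y = if ∥ x ∥ then leb x y else ltb x y

  insRow : A → List A → List A × Maybe A
  insRow x [] = [ x ] , nothing
  insRow x (y ∷ ys) with bumps x y
  ... | true  = (x ∷ ys) , just y
  ... | false with insRow x ys
  ...   | r , m = (y ∷ r) , m

  insert : List (List A) → A → List (List A)
  insert [] x = [ [ x ] ]
  insert (r ∷ rs) x with insRow x r
  ... | r' , nothing = r' ∷ rs
  ... | r' , just y  = r' ∷ insert rs y

  tableau : List A → List (List A)
  tableau w = foldl insert [] w

  -- columns (each listed top to bottom), left to right
  mergeCol : List A → List (List A) → List (List A)
  mergeCol [] cs = cs
  mergeCol (x ∷ xs) [] = [ x ] ∷ mergeCol xs []
  mergeCol (x ∷ xs) (c ∷ cs) = (x ∷ c) ∷ mergeCol xs cs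

  columnsTB : List (List A) → List (List A)
  columnsTB [] = []
  columnsTB (r ∷ rs) = mergeCol r (columnsTB rs)

  readings : List (List A) → List (List A)
  readings t = Data.List.map reverse (columnsTB t)

  colR : ℕ → List (List A) → List A
  colR _ [] = []
  colR zero (c ∷ _) = c
  colR (suc n) (_ ∷ cs) = colR n cs

  -- Juxtaposability: |u| ≥ |v| and the top-aligned juxtaposition of
  -- the columns u, v is a super tableau (rows compared from the top).

  rowOK : List A → List A → Bool
  rowOK _ [] = true
  rowOK [] (_ ∷ _) = false
  rowOK (x ∷ xs) (y ∷ ys) = (ltb x y ∨ (eqb x y ∧ not ∥ x ∥)) ∧ rowOK xs ys

  juxt : Col → Col → Bool
  juxt u v = (length (word v) ≤ᵇ length (word u))
           ∧ rowOK (reverse (word u)) (reverse (word v))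

  γ : Col → Col → List Col
  γ u v with readings (tableau (word u ++ word v))
  ... | w ∷ w' ∷ [] = toCols w ++ toCols w'
  ... | _           = toCols (word u ++ word v)

  record RStep : Set where
    constructor rstep
    field
      l  : List Col
      u  : Col
      v  : Col
      r  : List Col
      nj : T (not (juxt u v))

  srcR tgtR : RStep → List Col
  srcR (rstep l u v r _) = l ++ u ∷ v ∷ r
  tgtR (rstep l u v r _) = l ++ γ u v ++ r

  ColStep : Rel (List Col) 0ℓ
  ColStep a b = Σ RStep λ s → (a ≡ srcR s) × (b ≡ tgtR s)

  data Dir : Set where
    fwd bwd : Dir

  SStep : Set
  SStep = Dir × RStep

  src tgt : SStep → List Col
  src (fwd , s) = srcR s
  src (bwd , s) = tgtR s
  tgt (fwd , s) = tgtR s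
  tgt (bwd , s) = srcR s

  flip : SStep → SStep
  flip (fwd , s) = bwd , s
  flip (bwd , s) = fwd , s

  -- 2-cells of the free (2,1)-category Col₂(Σ)^⊤ are represented by
  -- composable zigzag sequences of steps (modulo the relations below).
  Valid : List Col → List SStep → List Col → Set
  Valid a [] b = a ≡ b
  Valid a (s ∷ ss) b = (a ≡ src s) × Valid (tgt s) ss b

  whiskS : List Col → List Col → SStep → SStep
  whiskS l' r' (d , rstep l u v r nj) = d , rstep (l' ++ l) u v (r ++ r') nj

  whisk : List Col → List Col → List SStep → List SStep
  whisk l' r' = Data.List.map (whiskS l' r')

  -- the step  c_l γ_{x,y} c_r  where x, y are possibly empty columns;
  -- identity if x or y is empty or (x,y) juxtaposable
  gstep : List Col → List Col → List Col → List Col → List SStep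
  gstep l (x ∷ []) (y ∷ []) r with T? (not (juxt x y))
  ... | yes p = [ fwd , rstep l x y r p ]
  ... | no  _ = []
  gstep _ _ _ _ = []

  Xsrc : Col → Col → Col → List SStep
  Xsrc u v t =
    let E  = toCols (colR 0 (readings (tableau (word u ++ word v))))
        E' = toCols (colR 1 (readings (tableau (word u ++ word v))))
        B  = toCols (colR 0 (readings (tableau (flat E' ++ word t))))
        B' = toCols (colR 1 (readings (tableau (flat E' ++ word t))))
    in gstep [] [ u ] [ v ] [ t ] ++ gstep E E' [ t ] [] ++ gstep [] E B B'

  Xtgt : Col → Col → Col → List SStep
  Xtgt u v t =
    let W  = toCols (colR 0 (readings (tableau (word v ++ word t))))
        W' = toCols (colR 1 (readings (tableau (word v ++ word t))))
        Ac = toCols (colR 0 (readings (tableau (word u ++ flat W))))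
        A' = toCols (colR 1 (readings (tableau (word u ++ flat W))))
    in gstep [ u ] [ v ] [ t ] [] ++ gstep [] [ u ] W W' ++ gstep Ac A' W' []

  -- Elementary identifications of 2-cells in the free (3,1)-category on
  -- Col₃(Σ): inverse laws, exchange law, whiskered generating 3-cells.

  data Elem : List SStep → List SStep → Set where
    inverse  : (s : SStep) → Elem (s ∷ flip s ∷ []) []
    exchange : (l m r : List Col) (u v u' v' : Col)
               (p : T (not (juxt u v))) (p' : T (not (juxt u' v'))) →
               Elem ((fwd , rstep l u v (m ++ u' ∷ v' ∷ r) p)
                     ∷ (fwd , rstep (l ++ γ u v ++ m) u' v' r p') ∷ [])
                    ((fwd , rstep (l ++ u ∷ v ∷ m) u' v' r p')
                     ∷ (fwd , rstep l u v (m ++ γ u' v' ++ r) p) ∷ [])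
    X        : (l r : List Col) (u v t : Col) →
               T (not (juxt u v)) → T (not (juxt v t)) →
               Elem (whisk l r (Xsrc u v t)) (whisk l r (Xtgt u v t))

  -- existence of a 3-cell between parallel 2-cells a ⇒ b in the free
  -- (3,1)-category generated by Col₃(Σ)
  data Homotopic (a b : List Col) : List SStep → List SStep → Set where
    hrefl  : ∀ {p} → Homotopic a b p p
    hsym   : ∀ {p q} → Homotopic a b p q → Homotopic a b q p
    htrans : ∀ {p q s} → Homotopic a b p q → Homotopic a b q s → Homotopic a b p s
    hgen   : (pre post L R : List SStep) → Elem L R →
             Valid a (pre ++ L ++ post) b → Valid a (pre ++ R ++ post) b →
             Homotopic a b (pre ++ L ++ post) (pre ++ R ++ post)

  IsHomotopyBasis : Set
  IsHomotopyBasis = ∀ (a b : List Col) (p q : List SStep) →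
    Valid a p b → Valid a q b → Homotopic a b p q

  data PStep : Rel (List A) 0ℓ where
    knuth1 : (pre post : List A) (x y z : A) → x ≤ y → y ≤ z →
             (x ≡ y → ∥ y ∥ ≡ false) → (y ≡ z → ∥ y ∥ ≡ true) →
             PStep (pre ++ z ∷ x ∷ y ∷ post) (pre ++ x ∷ z ∷ y ∷ post)
    knuth2 : (pre post : List A) (x y z : A) → x ≤ y → y ≤ z →
             (x ≡ y → ∥ y ∥ ≡ true) → (y ≡ z → ∥ y ∥ ≡ false) →
             PStep (pre ++ y ∷ z ∷ x ∷ post) (pre ++ y ∷ x ∷ z ∷ post)

  _≡P_ : Rel (List A) 0ℓ
  _≡P_ = EqClosure PStep

  _≡Col₂_ : Rel (List Col) 0ℓ
  _≡Col₂_ = EqClosure ColStep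

  -- Col₂(Σ) presents P(Σ) via c_u ↦ u: the induced monoid morphism
  -- Col* / ≡Col₂ → Σ* / ≡P is well defined, injective and surjective.
  PresentsP : Set
  PresentsP =
    (∀ (a b : List Col) → a ≡Col₂ b → flat a ≡P flat b)
    × (∀ (a b : List Col) → flat a ≡P flat b → a ≡Col₂ b)
    × (∀ (w : List A) → Σ (List Col) λ a → w ≡P flat a)

  IsCoherentPresentationOfP : Set
  IsCoherentPresentationOfP = PresentsP × IsHomotopyBasis

-- Write R x y if y may stand to the right of x in a row. R and its complement are transitive, and
-- this is all that the row insertion needs in order to respect the Knuth relations. So the
-- tableau is an invariant of the plactic class, and juxtaposed columns are recovered from it.
--
-- The columns of the tableau of uv come from matching the letters of u greedily with letters of v
-- to their right; equivalently, the letters of u are column-inserted into v, and the bumped ones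
-- form the second column. From this one sees that both sides of a 3-cell end in juxtaposed
-- columns: on the source side because enlarging the right-hand column only makes the matched
-- letters smaller, on the target side because juxtaposition survives each single insertion. Both
-- ends being tableaux of uvt, they coincide, so every overlap of two steps is filled by a 3-cell.
-- Steps move letters to the left, hence terminate, and Squier's argument gives the homotopy basis.

module Submission where

open import Defs
open import Data.Bool using (Bool; true; false; _∧_; _∨_; not; T)
open import Data.Bool.Properties using (T?; T-∧; T-irrelevant; not-involutive)
open import Data.Empty using (⊥; ⊥-elim)
open import Data.List
  using (List; []; _∷_; _++_; [_]; reverse; foldl; length; null; map; concatMap)
open import Data.List.Properties
  using (++-assoc; ++-identityʳ; foldl-++; unfold-reverse; reverse-involutive; concatMap-++;
         length-reverse; map-++; reverse-++; ∷-injectiveˡ; ∷-injectiveʳ)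
open import Data.List.Relation.Unary.All as All using (All; []; _∷_)
import Data.List.Relation.Unary.All.Properties as All
open import Data.List.Relation.Unary.AllPairs using (AllPairs; []; _∷_)
import Data.List.Relation.Unary.AllPairs.Properties as AllPairs
open import Data.List.Relation.Binary.Sublist.Propositional
  using (_⊆_; []; _∷_; _∷ʳ_; minimum; ⊆-refl)
import Data.List.Relation.Binary.Sublist.Propositional.Properties as Sublist
open import Data.List.Relation.Unary.Linked using (Linked; []; [-]; _∷_)
open import Data.List.Relation.Unary.Linked.Properties using (Linked⇒AllPairs; AllPairs⇒Linked)
open import Data.Maybe using (Maybe; just; nothing; maybe)
open import Data.Nat using (ℕ; suc; _+_; _<_; _≤_; z≤n; s≤s; _≤ᵇ_)
open import Data.Nat.Induction using (<-wellFounded)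
import Data.Nat.Properties as ℕ
open import Data.Product using (Σ; ∃₂; ∃-syntax; _×_; _,_; proj₁; proj₂)
open import Data.Sum using (_⊎_; inj₁; inj₂)
open import Data.Unit using (tt)
open import Function using (_∘_)
open import Function.Bundles using (Equivalence)
open import Induction.WellFounded using (Acc; acc)
open import Relation.Binary using (IsStrictTotalOrder; tri<; tri≈; tri>)
import Relation.Binary.Construct.Closure.Equivalence as Eq
open import Relation.Binary.Construct.Closure.ReflexiveTransitive using (ε; _◅_; _◅◅_)
open import Relation.Binary.Construct.Closure.Symmetric using (fwd; bwd)
open import Relation.Binary.PropositionalEquality hiding ([_])
open import Relation.Nullary using (¬_; yes; no)

module SuperPlactic (S : SignedAlphabet) where

  open SignedAlphabet S using (∥_∥; isSTO) renaming (_<_ to _≺_)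
  open IsStrictTotalOrder isSTO using (compare) renaming (trans to ≺-trans; irrefl to ≺-irrefl)
  open Super S hiding (_≤_)

  -- R x y: the letter y may stand to the right of x in a row; D x y: y may follow x in the
  -- bottom-to-top reading of a column. The two relations are complementary and both are
  -- transitive, and beyond this nothing about the order and the signs is used.
  r : A → A → Bool
  r x y = ltb x y ∨ (eqb x y ∧ not ∥ x ∥)

  R D : A → A → Set
  R x y = r x y ≡ true
  D x y = r x y ≡ false

  R⊎D : ∀ x y → R x y ⊎ D x y
  R⊎D x y with r x y
  ... | true  = inj₁ refl
  ... | false = inj₂ refl

  R-D-⊥ : ∀ {x y} {B : Set} → R x y → D x y → B
  R-D-⊥ p q with trans (sym p) q
  ... | ()

  ≺⇒R : ∀ {x y} → x ≺ y → R x y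
  ≺⇒R {x} {y} p with compare x y
  ... | tri< _ _ _   = refl
  ... | tri≈ _ refl _ = ⊥-elim (≺-irrefl refl p)
  ... | tri> ¬p _ _  = ⊥-elim (¬p p)

  ≻⇒D : ∀ {x y} → y ≺ x → D x y
  ≻⇒D {x} {y} p with compare x y
  ... | tri< _ _ ¬p  = ⊥-elim (¬p p)
  ... | tri≈ _ _ ¬p  = ⊥-elim (¬p p)
  ... | tri> _ _ _   = refl

  r-diagonal : ∀ x → r x x ≡ not ∥ x ∥
  r-diagonal x with compare x x
  ... | tri< p _ _ = ⊥-elim (≺-irrefl refl p)
  ... | tri≈ _ _ _ = refl
  ... | tri> _ _ p = ⊥-elim (≺-irrefl refl p)

  even⇒R : ∀ {x} → ∥ x ∥ ≡ false → R x x
  even⇒R {x} p = trans (r-diagonal x) (cong not p)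

  odd⇒D : ∀ {x} → ∥ x ∥ ≡ true → D x x
  odd⇒D {x} p = trans (r-diagonal x) (cong not p)

  R⇒ : ∀ {x y} → R x y → x ≺ y ⊎ (x ≡ y × ∥ x ∥ ≡ false)
  R⇒ {x} {y} p with compare x y
  R⇒ p  | tri< q _ _ = inj₁ q
  R⇒ {x} p | tri≈ _ q _ with ∥ x ∥
  R⇒ p  | tri≈ _ q _ | false = inj₂ (q , refl)

  D⇒ : ∀ {x y} → D x y → y ≺ x ⊎ (x ≡ y × ∥ x ∥ ≡ true)
  D⇒ {x} {y} p with compare x y
  D⇒ p  | tri> _ _ q = inj₁ q
  D⇒ {x} p | tri≈ _ q _ with ∥ x ∥
  D⇒ p  | tri≈ _ q _ | true = inj₂ (q , refl)

  R-trans : ∀ {x y z} → R x y → R y z → R x z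
  R-trans p q with R⇒ p | R⇒ q
  ... | inj₁ a          | inj₁ b          = ≺⇒R (≺-trans a b)
  ... | inj₁ a          | inj₂ (refl , _) = p
  ... | inj₂ (refl , _) | _               = q

  D-trans : ∀ {x y z} → D x y → D y z → D x z
  D-trans p q with D⇒ p | D⇒ q
  ... | inj₁ a          | inj₁ b          = ≻⇒D (≺-trans b a)
  ... | inj₁ a          | inj₂ (refl , _) = p
  ... | inj₂ (refl , _) | _               = q

  -- In each of the four mixed laws, the opposite conclusion would compose with one hypothesis by
  -- transitivity and contradict the other.
  RD⇒R : ∀ {x y z} → R x y → D z y → R x z
  RD⇒R {x} {z = z} p q with R⊎D x z
  ... | inj₁ s = s
  ... | inj₂ s = R-D-⊥ p (D-trans s q)

  RD⇒D : ∀ {x y z} → R x y → D z y → D z x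
  RD⇒D {x} {z = z} p q with R⊎D z x
  ... | inj₁ s = R-D-⊥ (R-trans s p) q
  ... | inj₂ s = s

  DR⇒R : ∀ {x y z} → D y z → R y x → R z x
  DR⇒R {x} {z = z} p q with R⊎D z x
  ... | inj₁ s = s
  ... | inj₂ s = R-D-⊥ q (D-trans p s)

  DR⇒D : ∀ {x y z} → D y z → R y x → D x z
  DR⇒D {x} {z = z} p q with R⊎D x z
  ... | inj₁ s = R-D-⊥ (R-trans q s) p
  ... | inj₂ s = s

  -- `bumps` reads the sign of the inserted letter, `R` that of the letter already in the row. Signs
  -- matter only when the two letters are equal, so the tests agree.
  bumps-R : ∀ {x y} → R y x → bumps x y ≡ false
  bumps-R {x} {y} p with R⇒ p | compare x y | ∥ x ∥ in s
  ... | _              | tri< q _ _    | _ = R-D-⊥ p (≻⇒D q)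
  ... | inj₁ q         | tri≈ _ refl _ | _ = ⊥-elim (≺-irrefl refl q)
  ... | inj₂ (refl , q) | tri≈ _ _ _   | true with trans (sym q) s
  ...   | ()
  bumps-R {x} {y} p | _ | tri≈ _ _ _ | false = refl
  bumps-R {x} {y} p | _ | tri> _ _ _ | true  = refl
  bumps-R {x} {y} p | _ | tri> _ _ _ | false = refl

  bumps-D : ∀ {x y} → D y x → bumps x y ≡ true
  bumps-D {x} {y} p with D⇒ p | compare x y | ∥ x ∥ in s
  ... | _              | tri> _ _ q    | _ = R-D-⊥ (≺⇒R q) p
  ... | inj₁ q         | tri≈ _ refl _ | _ = ⊥-elim (≺-irrefl refl q)
  ... | inj₂ (refl , q) | tri≈ _ _ _   | false with trans (sym q) s
  ...   | ()
  bumps-D {x} {y} p | _ | tri≈ _ _ _ | true  = refl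
  bumps-D {x} {y} p | _ | tri< _ _ _ | true  = refl
  bumps-D {x} {y} p | _ | tri< _ _ _ | false = refl

  -- Row insertion and Knuth relations

  -- The graph of `insRow`, with `R` and `D` as the bumping test, so that insertions can be analysed
  -- by pattern matching.
  data Row (x : A) : List A → List A → Maybe A → Set where
    end  : Row x [] [ x ] nothing
    bump : ∀ {y ys} → D y x → Row x (y ∷ ys) (x ∷ ys) (just y)
    pass : ∀ {y ys zs m} → R y x → Row x ys zs m → Row x (y ∷ ys) (y ∷ zs) m

  insRow⇒Row : ∀ x ys → ∃₂ (Row x ys)
  insRow⇒Row x [] = _ , _ , end
  insRow⇒Row x (y ∷ ys) with R⊎D y x | insRow⇒Row x ys
  ... | inj₁ p | _ , _ , q = _ , _ , pass p q
  ... | inj₂ p | _         = _ , _ , bump p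

  Row⇒insRow : ∀ {x ys zs m} → Row x ys zs m → insRow x ys ≡ (zs , m)
  Row⇒insRow end                             = refl
  Row⇒insRow {x} (bump {y} p) rewrite bumps-D p = refl
  Row⇒insRow (pass p q) rewrite bumps-R p | Row⇒insRow q = refl

  Row-All : ∀ {P : A → Set} {x ys zs m} → P x → All P ys → Row x ys zs m → All P zs
  Row-All px _        end        = px ∷ []
  Row-All px (_ ∷ ps) (bump _)   = px ∷ ps
  Row-All px (p ∷ ps) (pass _ q) = p ∷ Row-All px ps q

  Row-bumped : ∀ {x ys zs y} → Row x ys zs (just y) → D y x
  Row-bumped (bump p)   = p
  Row-bumped (pass _ q) = Row-bumped q

  bumped-All : ∀ {P : A → Set} {x ys zs y} → All P ys → Row x ys zs (just y) → P y
  bumped-All (p ∷ _)  (bump _)   = p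
  bumped-All (_ ∷ ps) (pass _ a) = bumped-All ps a

  Row-sorted : ∀ {x ys zs m} → AllPairs R ys → Row x ys zs m → AllPairs R zs
  Row-sorted _        end        = [] ∷ []
  Row-sorted (a ∷ as) (bump p)   = All.map (DR⇒R p) a ∷ as
  Row-sorted (a ∷ as) (pass p q) = Row-All p a q ∷ Row-sorted as q

  -- Insertion of a whole word into a single row; the last index is the word of bumped letters, in
  -- the order in which the next row receives them.
  data Rows : List A → List A → List A → List A → Set where
    done  : ∀ {ys} → Rows ys [] ys []
    plain : ∀ {x w ys ys′ zs o} → Row x ys ys′ nothing → Rows ys′ w zs o → Rows ys (x ∷ w) zs o
    emit  : ∀ {x w ys ys′ zs o y} → Row x ys ys′ (just y) → Rows ys′ w zs o →
            Rows ys (x ∷ w) zs (y ∷ o)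

  Rows-pass : ∀ {c w ys zs o} → All (R c) w → Rows ys w zs o → Rows (c ∷ ys) w (c ∷ zs) o
  Rows-pass ps       done        = done
  Rows-pass (p ∷ ps) (plain a q) = plain (pass p a) (Rows-pass ps q)
  Rows-pass (p ∷ ps) (emit a q)  = emit (pass p a) (Rows-pass ps q)

  -- The lower rows only see the bumped letters in their order, so the top row may process the whole
  -- word first.
  insert-Rows : ∀ {ys w zs o} t → Rows ys w zs o → foldl insert (ys ∷ t) w ≡ zs ∷ foldl insert t o
  insert-Rows t done = refl
  insert-Rows t (plain a q) rewrite Row⇒insRow a = insert-Rows t q
  insert-Rows t (emit {y = y} a q) rewrite Row⇒insRow a = insert-Rows (insert t y) q

  data Knuth : List A → List A → Set where
    k₁ : ∀ {x y z} → R x y → D z y → Knuth (z ∷ x ∷ y ∷ []) (x ∷ z ∷ y ∷ [])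
    k₂ : ∀ {x y z} → D y x → R y z → Knuth (y ∷ z ∷ x ∷ []) (y ∷ x ∷ z ∷ [])

  data Knuth≡ : List A → List A → Set where
    same  : ∀ {w} → Knuth≡ w w
    knuth : ∀ {w w′} → Knuth w w′ → Knuth≡ w w′
    knuth˘ : ∀ {w w′} → Knuth w w′ → Knuth≡ w′ w

  data Bumped (Q : A → A → Set) : Maybe A → Maybe A → Set where
    none : ∀ {m} → Bumped Q nothing m
    both : ∀ {a b} → Q a b → Bumped Q (just a) (just b)

  -- The letter `y` cannot pass `z`, which is now in the row, so it bumps `z` itself or an entry
  -- that `z` passed. Both are suitably smaller than the letter bumped by `z`.
  Row-D : ∀ {y z ys ys′ ys″ m m′} → D z y → AllPairs R ys →
          Row z ys ys′ m → Row y ys′ ys″ m′ → Bumped D m m′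
  Row-D p _        end        _          = none
  Row-D p _        (bump q)   (bump s)   = both q
  Row-D p _        (bump q)   (pass s _) = R-D-⊥ s p
  Row-D {m = nothing} p _ (pass q a) b   = none
  Row-D {m = just _}  p _ (pass q a) (bump s) = both (RD⇒D q (Row-bumped a))
  Row-D {m = just _}  p (_ ∷ o) (pass q a) (pass s b) = Row-D p o a b

  -- The letter `z` passes `y`, so anything it bumps stood further right in the sorted row than what
  -- `y` bumped.
  Row-R : ∀ {y z ys ys′ ys″ m m′} → R y z → AllPairs R ys →
          Row y ys ys′ m → Row z ys′ ys″ m′ → Bumped (λ a b → R b a) m′ m
  Row-R p _       end        (bump s)     = R-D-⊥ p s
  Row-R p _       end        (pass s end) = none
  Row-R p _       (bump q)   (bump s)     = R-D-⊥ p s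
  Row-R {m′ = nothing} p _ _ _            = none
  Row-R {m′ = just _} p (o ∷ _) (bump q) (pass s a) = both (bumped-All o a)
  Row-R {m′ = just _} p (_ ∷ o) (pass q a) (bump s) = R-D-⊥ (R-trans q p) s
  Row-R {m′ = just _} p (_ ∷ o) (pass q a) (pass s b) = Row-R p o a b

  Rows-knuth-[] : ∀ {w w′} → Knuth w w′ → ∃[ zs ] ∃[ o ] Rows [] w zs o × Rows [] w′ zs o
  Rows-knuth-[] (k₁ p q) =
    _ , _ ,
    plain end (emit (bump (RD⇒D p q)) (plain (pass p end) done)) ,
    plain end (plain (pass (RD⇒R p q) end) (emit (pass p (bump q)) done))
  Rows-knuth-[] (k₂ p q) =
    _ , _ ,
    plain end (plain (pass q end) (emit (bump p) done)) ,
    plain end (emit (bump p) (plain (pass (DR⇒R p q) end) done))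

  -- In both relations `x` is the smallest letter, so an entry passed by `x` is passed by all three.
  -- The induction strips such entries, and the cases arise at the first entry bumped by `x`.
  Rows-knuth : ∀ {w w′ ys} → AllPairs R ys → Knuth w w′ →
               ∃[ zs ] ∃[ o ] ∃[ o′ ] Rows ys w zs o × Rows ys w′ zs o′ × Knuth≡ o o′
  Rows-knuth [] k with Rows-knuth-[] k
  ... | _ , _ , i , i′ = _ , _ , _ , i , i′ , same
  Rows-knuth {ys = c ∷ ys} (a ∷ as) k@(k₁ {x} {y} {z} p q) with R⊎D c x | R⊎D c z
  ... | inj₁ cx | _ with Rows-knuth as k
  ...   | _ , _ , _ , i , i′ , e =
    _ , _ , _ ,
    Rows-pass (R-trans cx (RD⇒R p q) ∷ cx ∷ R-trans cx p ∷ []) i ,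
    Rows-pass (cx ∷ R-trans cx (RD⇒R p q) ∷ R-trans cx p ∷ []) i′ ,
    e
  Rows-knuth {ys = _ ∷ []} (_ ∷ _) (k₁ p q) | inj₂ cx | inj₂ cz =
    _ , _ , _ ,
    emit (bump cz) (emit (bump (RD⇒D p q)) (plain (pass p end) done)) ,
    emit (bump cx) (plain (pass (RD⇒R p q) end) (emit (pass p (bump q)) done)) ,
    same
  -- The bumped words are `c z d` and `c d z`: a relation of the other kind, read backwards. This is
  -- why `Knuth≡` allows both directions.
  Rows-knuth {ys = _ ∷ d ∷ _} ((cd ∷ _) ∷ _) (k₁ p q) | inj₂ cx | inj₂ cz =
    _ , _ , _ ,
    emit (bump cz) (emit (bump (RD⇒D p q)) (emit (pass p (bump (D-trans dz q))) done)) ,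
    emit (bump cx) (emit (pass (RD⇒R p q) (bump dz)) (emit (pass p (bump q)) done)) ,
    knuth˘ (k₂ cz cd)
    where dz = DR⇒D cz cd
  Rows-knuth {ys = _ ∷ ys} (a ∷ as) (k₁ {x} {y} {z} p q) | inj₂ cx | inj₁ cz
    with insRow⇒Row z ys
  ... | ys′ , m , i with insRow⇒Row y ys′
  ...   | ys″ , m′ , i′ with m | m′ | i | i′ | Row-D q as i i′
  ...     | nothing | nothing | i | i′ | none =
    _ , _ , _ ,
    plain (pass cz i) (emit (bump cx) (plain (pass p i′) done)) ,
    emit (bump cx) (plain (pass (RD⇒R p q) i) (plain (pass p i′) done)) ,
    same
  ...     | nothing | just _ | i | i′ | none =
    _ , _ , _ ,
    plain (pass cz i) (emit (bump cx) (emit (pass p i′) done)) ,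
    emit (bump cx) (plain (pass (RD⇒R p q) i) (emit (pass p i′) done)) ,
    same
  ...     | just _ | just b | i | i′ | both d =
    _ , _ , _ ,
    emit (pass cz i) (emit (bump cx) (emit (pass p i′) done)) ,
    emit (bump cx) (emit (pass (RD⇒R p q) i) (emit (pass p i′) done)) ,
    knuth (k₁ (bumped-All (Row-All cz a i) i′) d)
  Rows-knuth {ys = c ∷ ys} (a ∷ as) k@(k₂ {x} {y} {z} p q) with R⊎D c x | R⊎D c y
  ... | inj₁ cx | _ with Rows-knuth as k
  ...   | _ , _ , _ , i , i′ , e =
    _ , _ , _ ,
    Rows-pass (RD⇒R cx p ∷ R-trans cx (DR⇒R p q) ∷ cx ∷ []) i ,
    Rows-pass (RD⇒R cx p ∷ cx ∷ R-trans cx (DR⇒R p q) ∷ []) i′ ,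
    e
  Rows-knuth (a ∷ as) (k₂ {x} {y} {z} p q) | inj₂ cx | inj₂ cy with insRow⇒Row z _
  ... | _ , nothing , i =
    _ , _ , _ ,
    emit (bump cy) (plain (pass q i) (emit (bump p) done)) ,
    emit (bump cy) (emit (bump p) (plain (pass (DR⇒R p q) i) done)) ,
    same
  ... | _ , just _ , i =
    _ , _ , _ ,
    emit (bump cy) (emit (pass q i) (emit (bump p) done)) ,
    emit (bump cy) (emit (bump p) (emit (pass (DR⇒R p q) i) done)) ,
    knuth (k₂ cy (bumped-All a i))
  Rows-knuth {ys = c ∷ ys} (a ∷ as) (k₂ {x} {y} {z} p q) | inj₂ cx | inj₁ cy
    with insRow⇒Row y ys
  ... | ys′ , m , i with insRow⇒Row z ys′
  ...   | ys″ , m′ , i′ with m | m′ | i | i′ | Row-R q as i i′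
  ...     | nothing | nothing | i | i′ | none =
    _ , _ , _ ,
    plain (pass cy i) (plain (pass (R-trans cy q) i′) (emit (bump cx) done)) ,
    plain (pass cy i) (emit (bump cx) (plain (pass (DR⇒R p q) i′) done)) ,
    same
  ...     | just _ | nothing | i | i′ | none =
    _ , _ , _ ,
    emit (pass cy i) (plain (pass (R-trans cy q) i′) (emit (bump cx) done)) ,
    emit (pass cy i) (emit (bump cx) (plain (pass (DR⇒R p q) i′) done)) ,
    same
  ...     | just b | just _ | i | i′ | both d =
    _ , _ , _ ,
    emit (pass cy i) (emit (pass (R-trans cy q) i′) (emit (bump cx) done)) ,
    emit (pass cy i) (emit (bump cx) (emit (pass (DR⇒R p q) i′) done)) ,
    knuth (k₂ (RD⇒D cy (Row-bumped i)) d)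

  SortedRows : List (List A) → Set
  SortedRows = All (AllPairs R)

  insert-sorted : ∀ {t} x → SortedRows t → SortedRows (insert t x)
  insert-sorted x [] = ([] ∷ []) ∷ []
  insert-sorted {ys ∷ _} x (a ∷ as) with insRow⇒Row x ys
  ... | _ , nothing , i rewrite Row⇒insRow i = Row-sorted a i ∷ as
  ... | _ , just y  , i rewrite Row⇒insRow i = Row-sorted a i ∷ insert-sorted y as

  inserts-sorted : ∀ {t} w → SortedRows t → SortedRows (foldl insert t w)
  inserts-sorted []      a = a
  inserts-sorted (x ∷ w) a = inserts-sorted w (insert-sorted x a)

  -- Row by row: the current row ends up the same, and the next one receives equal words or again a
  -- single Knuth relation.
  insert-knuth : ∀ {w w′} t → SortedRows t → Knuth w w′ → foldl insert t w ≡ foldl insert t w′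
  insert-knuth [] _ k with Rows-knuth-[] k
  insert-knuth [] _ (k₁ p q) | _ , _ , i , i′ = trans (insert-Rows [] i) (sym (insert-Rows [] i′))
  insert-knuth [] _ (k₂ p q) | _ , _ , i , i′ = trans (insert-Rows [] i) (sym (insert-Rows [] i′))
  insert-knuth (ys ∷ t) (a ∷ as) k with Rows-knuth a k
  ... | _ , _ , _ , i , i′ , e = trans (insert-Rows t i)
    (trans (cong (_ ∷_) (go e)) (sym (insert-Rows t i′)))
    where
    go : ∀ {o o′} → Knuth≡ o o′ → foldl insert t o ≡ foldl insert t o′
    go same       = refl
    go (knuth k)  = insert-knuth t as k
    go (knuth˘ k) = sym (insert-knuth t as k)

  -- The plactic congruence and its invariant

  ≤⇒R : ∀ {x y} → x ≺ y ⊎ x ≡ y → (x ≡ y → ∥ y ∥ ≡ false) → R x y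
  ≤⇒R (inj₁ p)    _ = ≺⇒R p
  ≤⇒R (inj₂ refl) q = even⇒R (q refl)

  ≤⇒D : ∀ {x y} → x ≺ y ⊎ x ≡ y → (x ≡ y → ∥ x ∥ ≡ true) → D y x
  ≤⇒D (inj₁ p)    _ = ≻⇒D p
  ≤⇒D (inj₂ refl) q = odd⇒D (q refl)

  R⇒≤ : ∀ {x y} → R x y → (x ≺ y ⊎ x ≡ y) × (x ≡ y → ∥ y ∥ ≡ false)
  R⇒≤ p with R⇒ p
  ... | inj₁ q          = inj₁ q , λ e → ⊥-elim (≺-irrefl e q)
  ... | inj₂ (refl , q) = inj₂ refl , λ _ → q

  D⇒≤ : ∀ {x y} → D y x → (x ≺ y ⊎ x ≡ y) × (x ≡ y → ∥ x ∥ ≡ true)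
  D⇒≤ p with D⇒ p
  ... | inj₁ q          = inj₁ q , λ e → ⊥-elim (≺-irrefl e q)
  ... | inj₂ (refl , q) = inj₂ refl , λ _ → q

  Knuth⇒PStep : ∀ {w w′} pre post → Knuth w w′ → PStep (pre ++ w ++ post) (pre ++ w′ ++ post)
  Knuth⇒PStep pre post (k₁ p q) with R⇒≤ p | D⇒≤ q
  ... | a , b | c , d = knuth1 pre post _ _ _ a c b d
  Knuth⇒PStep pre post (k₂ p q) with D⇒≤ p | R⇒≤ q
  ... | a , b | c , d = knuth2 pre post _ _ _ a c (λ { refl → b refl }) (λ { refl → d refl })

  PStep⇒Knuth : ∀ {w w′} → PStep w w′ → ∃₂ λ pre post → ∃₂ λ k k′ →
                Knuth k k′ × w ≡ pre ++ k ++ post × w′ ≡ pre ++ k′ ++ post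
  PStep⇒Knuth (knuth1 pre post x y z a b c d) =
    pre , post , _ , _ , k₁ (≤⇒R a c) (≤⇒D b d) , refl , refl
  PStep⇒Knuth (knuth2 pre post x y z a b c d) =
    pre , post , _ , _ , k₂ (≤⇒D a (λ { refl → c refl })) (≤⇒R b (λ { refl → d refl })) , refl , refl

  tableau-PStep : ∀ {w w′} → PStep w w′ → tableau w ≡ tableau w′
  tableau-PStep p with PStep⇒Knuth p
  ... | pre , post , k , k′ , q , refl , refl =
    trans (unfold k) (trans (cong (λ t → foldl insert t post)
      (insert-knuth (tableau pre) (inserts-sorted pre []) q)) (sym (unfold k′)))
    where
    unfold : ∀ k → tableau (pre ++ k ++ post) ≡ foldl insert (foldl insert (tableau pre) k) post
    unfold k = trans (foldl-++ insert [] pre _) (foldl-++ insert (tableau pre) k post)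

  -- _≡P_ has the default fixity, which binds tighter than _++_.
  infix 4 _∼_
  _∼_ : List A → List A → Set
  _∼_ = _≡P_

  tableau-∼ : ∀ {w w′} → w ∼ w′ → tableau w ≡ tableau w′
  tableau-∼ ε            = refl
  tableau-∼ (fwd p ◅ ps) = trans (tableau-PStep p) (tableau-∼ ps)
  tableau-∼ (bwd p ◅ ps) = trans (sym (tableau-PStep p)) (tableau-∼ ps)

  ∼-reflexive : ∀ {w w′} → w ≡ w′ → w ∼ w′
  ∼-reflexive refl = ε

  PStep-++ˡ : ∀ c {w w′} → PStep w w′ → PStep (c ++ w) (c ++ w′)
  PStep-++ˡ c (knuth1 pre post x y z p q s t) =
    subst₂ PStep (++-assoc c pre _) (++-assoc c pre _) (knuth1 (c ++ pre) post x y z p q s t)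
  PStep-++ˡ c (knuth2 pre post x y z p q s t) =
    subst₂ PStep (++-assoc c pre _) (++-assoc c pre _) (knuth2 (c ++ pre) post x y z p q s t)

  PStep-++ʳ : ∀ c {w w′} → PStep w w′ → PStep (w ++ c) (w′ ++ c)
  PStep-++ʳ c (knuth1 pre post x y z p q s t) =
    subst₂ PStep (sym (++-assoc pre _ c)) (sym (++-assoc pre _ c))
      (knuth1 pre (post ++ c) x y z p q s t)
  PStep-++ʳ c (knuth2 pre post x y z p q s t) =
    subst₂ PStep (sym (++-assoc pre _ c)) (sym (++-assoc pre _ c))
      (knuth2 pre (post ++ c) x y z p q s t)

  ∼-++ˡ : ∀ c {w w′} → w ∼ w′ → c ++ w ∼ c ++ w′
  ∼-++ˡ c = Eq.gmap (c ++_) (PStep-++ˡ c)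

  ∼-++ʳ : ∀ c {w w′} → w ∼ w′ → w ++ c ∼ w′ ++ c
  ∼-++ʳ c = Eq.gmap (_++ c) (PStep-++ʳ c)

  -- Products of two columns

  -- Columns are handled from top to bottom, so that the letters below a given one come after it.
  Column : List A → Set
  Column = AllPairs (λ x y → D y x)

  -- Column insertion of one letter, from the top of the column downwards; a bumped letter is handed
  -- to the column on the right.
  data Push (x : A) : List A → List A → Maybe A → Set where
    end  : Push x [] [ x ] nothing
    bump : ∀ {y ys} → R x y → Push x (y ∷ ys) (x ∷ ys) (just y)
    pass : ∀ {y ys zs m} → D x y → Push x ys zs m → Push x (y ∷ ys) (y ∷ zs) m

  -- Column insertion of u, the smallest letter first; the last index lists the bumped letters.
  data Pushes : List A → List A → List A → List A → Set where
    done  : ∀ {v} → Pushes [] v v []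
    plain : ∀ {x u v v′ w w′} → Push x v v′ nothing → Pushes u v′ w w′ → Pushes (x ∷ u) v w w′
    emit  : ∀ {x u v v′ w w′ y} → Push x v v′ (just y) → Pushes u v′ w w′ →
            Pushes (x ∷ u) v w (y ∷ w′)

  -- The columns w, w′ of the tableau of uv by matching each letter of u, from the top, with the
  -- first available letter of v that may stand to its right.
  data Greedy : List A → List A → List A → List A → Set where
    doneˡ : ∀ {v} → Greedy [] v v []
    doneʳ : ∀ {x u} → Greedy (x ∷ u) [] (x ∷ u) []
    match : ∀ {x u y v w w′} → R x y → Greedy u v w w′ → Greedy (x ∷ u) (y ∷ v) (x ∷ w) (y ∷ w′)
    skip  : ∀ {x u y v w w′} → D x y → Greedy (x ∷ u) v w w′ → Greedy (x ∷ u) (y ∷ v) (y ∷ w) w′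

  greedy : ∀ u v → ∃₂ (Greedy u v)
  greedy []      v  = _ , _ , doneˡ
  greedy (x ∷ u) [] = _ , _ , doneʳ
  greedy (x ∷ u) (y ∷ v) with R⊎D x y
  ... | inj₁ p with greedy u v
  ...   | _ , _ , g = _ , _ , match p g
  greedy (x ∷ u) (y ∷ v) | inj₂ p with greedy (x ∷ u) v
  ...   | _ , _ , g = _ , _ , skip p g

  Pushes-pass : ∀ {y u v w w′} → All (λ x → D x y) u → Pushes u v w w′ →
                Pushes u (y ∷ v) (y ∷ w) w′
  Pushes-pass ps       done        = done
  Pushes-pass (p ∷ ps) (plain a q) = plain (pass p a) (Pushes-pass ps q)
  Pushes-pass (p ∷ ps) (emit a q)  = emit (pass p a) (Pushes-pass ps q)

  -- A letter of `v` once skipped, or a letter of `u` once placed, is passed by all lower letters of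
  -- `u`. Hence the matching, which never looks back, agrees with column insertion.
  Greedy⇒Pushes : ∀ {u v w w′} → Column u → Greedy u v w w′ → Pushes u v w w′
  Greedy⇒Pushes _ doneˡ = done
  Greedy⇒Pushes (a ∷ as) doneʳ = plain end (Pushes-pass a (appendAll as))
    where
    appendAll : ∀ {u} → Column u → Pushes u [] u []
    appendAll []       = done
    appendAll (a ∷ as) = plain end (Pushes-pass a (appendAll as))
  Greedy⇒Pushes (a ∷ as) (match p g) = emit (bump p) (Pushes-pass a (Greedy⇒Pushes as g))
  Greedy⇒Pushes c@(a ∷ _) (skip p g) =
    Pushes-pass (p ∷ All.map (λ q → D-trans q p) a) (Greedy⇒Pushes c g)

  Push-All : ∀ {P : A → Set} {x v w m} → P x → All P v → Push x v w m → All P w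
  Push-All px _        end        = px ∷ []
  Push-All px (_ ∷ ps) (bump _)   = px ∷ ps
  Push-All px (p ∷ ps) (pass _ a) = p ∷ Push-All px ps a

  Push-bumped : ∀ {x v w y} → Push x v w (just y) → R x y
  Push-bumped (bump p)   = p
  Push-bumped (pass _ a) = Push-bumped a

  Push-Column : ∀ {x v w m} → Column v → Push x v w m → Column w
  Push-Column _        end        = [] ∷ []
  Push-Column (a ∷ as) (bump p)   = All.map (RD⇒D p) a ∷ as
  Push-Column (a ∷ as) (pass p q) = Push-All p a q ∷ Push-Column as q

  Greedy-All : ∀ {P : A → Set} {u v w w′} → All P u → All P v → Greedy u v w w′ → All P w
  Greedy-All ps       qs       doneˡ       = qs
  Greedy-All ps       qs       doneʳ       = ps
  Greedy-All (p ∷ ps) (q ∷ qs) (match _ g) = p ∷ Greedy-All ps qs g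
  Greedy-All ps       (q ∷ qs) (skip _ g)  = q ∷ Greedy-All ps qs g

  Greedy-Columnˡ : ∀ {u v w w′} → Column u → Column v → Greedy u v w w′ → Column w
  Greedy-Columnˡ _        d        doneˡ       = d
  Greedy-Columnˡ c        _        doneʳ       = c
  Greedy-Columnˡ (a ∷ as) (b ∷ bs) (match p g) =
    Greedy-All a (All.map (RD⇒D p) b) g ∷ Greedy-Columnˡ as bs g
  Greedy-Columnˡ c@(a ∷ _) (b ∷ bs) (skip p g) =
    Greedy-All (p ∷ All.map (λ q → D-trans q p) a) b g ∷ Greedy-Columnˡ c bs g

  Greedy-⊆ʳ : ∀ {u v w w′} → Greedy u v w w′ → w′ ⊆ v
  Greedy-⊆ʳ doneˡ       = minimum _
  Greedy-⊆ʳ doneʳ       = []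
  Greedy-⊆ʳ (match _ g) = refl ∷ Greedy-⊆ʳ g
  Greedy-⊆ʳ (skip _ g)  = _ ∷ʳ Greedy-⊆ʳ g

  Greedy-⊆ˡ : ∀ {u v w w′} → Greedy u v w w′ → u ⊆ w
  Greedy-⊆ˡ doneˡ       = minimum _
  Greedy-⊆ˡ doneʳ       = ⊆-refl
  Greedy-⊆ˡ (match _ g) = refl ∷ Greedy-⊆ˡ g
  Greedy-⊆ˡ (skip _ g)  = _ ∷ʳ Greedy-⊆ˡ g

  Greedy-Columnʳ : ∀ {u v w w′} → Column v → Greedy u v w w′ → Column w′
  Greedy-Columnʳ c g = Column-⊆ (Greedy-⊆ʳ g) c
    where
    Column-⊆ : ∀ {xs ys} → xs ⊆ ys → Column ys → Column xs
    Column-⊆ []         _        = []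
    Column-⊆ (_ ∷ʳ s)   (_ ∷ as) = Column-⊆ s as
    Column-⊆ (refl ∷ s) (a ∷ as) = Sublist.All-resp-⊆ s a ∷ Column-⊆ s as

  -- The letter `x` travels right through the column by relations of the first kind, the next higher
  -- letter of the column serving as the third letter of each relation.
  slide : ∀ {x y} v → Column (y ∷ v) → R x y → x ∷ reverse v ++ [ y ] ∼ reverse v ++ x ∷ y ∷ []
  slide [] _ _ = ε
  slide {x} {y} (z ∷ v) ((d ∷ _) ∷ as) p =
    ∼-reflexive (cong (λ s → x ∷ s ++ [ y ]) (unfold-reverse z v))
    ◅◅ ∼-++ʳ [ y ] (slide v as (RD⇒R p d))
    ◅◅ ∼-reflexive (++-assoc (reverse v) _ _)
    ◅◅ bwd (Knuth⇒PStep (reverse v) [] (k₁ p d)) ◅ ε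
    ◅◅ ∼-reflexive (sym (++-assoc (reverse v) [ z ] _))
    ◅◅ ∼-reflexive (cong (_++ x ∷ y ∷ []) (sym (unfold-reverse z v)))

  -- If the top letter is bumped, this is `slide`. If it is passed, the induction treats the column
  -- below it, and the bumped letter must then be exchanged with the top letter.
  Push-∼ : ∀ {x v w m} → Column v → Push x v w m →
            x ∷ reverse v ∼ reverse w ++ maybe [_] [] m
  Push-∼ _ end = ε
  Push-∼ {x} {y ∷ v} c (bump p) =
    ∼-reflexive (cong (x ∷_) (unfold-reverse y v))
    ◅◅ slide v c p
    ◅◅ ∼-reflexive (sym (++-assoc (reverse v) [ x ] [ y ]))
    ◅◅ ∼-reflexive (cong (_++ [ y ]) (sym (unfold-reverse x v)))
  Push-∼ {x} {y ∷ v} {y ∷ w} {m} (a ∷ as) (pass p q) =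
    ∼-reflexive (cong (x ∷_) (unfold-reverse y v))
    ◅◅ ∼-++ʳ [ y ] (Push-∼ as q)
    ◅◅ ∼-reflexive (++-assoc (reverse w) _ [ y ])
    ◅◅ swap q a
    ◅◅ ∼-reflexive (sym (++-assoc (reverse w) [ y ] _))
    ◅◅ ∼-reflexive (cong (_++ _) (sym (unfold-reverse y w)))
    where
    -- A relation of the second kind needs a third letter on the left: the top letter `h` of the
    -- column just produced.
    swapHead : ∀ {h z} w → D h y → R h z →
               reverse (h ∷ w) ++ z ∷ y ∷ [] ∼ reverse (h ∷ w) ++ y ∷ z ∷ []
    swapHead {h} {z} w d e =
      ∼-reflexive (trans (cong (_++ _) (unfold-reverse h w)) (++-assoc (reverse w) [ h ] _))
      ◅◅ fwd (Knuth⇒PStep (reverse w) [] (k₂ d e)) ◅ ε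
      ◅◅ ∼-reflexive (sym (trans (cong (_++ _) (unfold-reverse h w)) (++-assoc (reverse w) [ h ] _)))
    swap : ∀ {v w m} → Push x v w m → All (λ z → D z y) v →
           reverse w ++ maybe [_] [] m ++ [ y ] ∼
           reverse w ++ [ y ] ++ maybe [_] [] m
    swap {m = nothing} _ _ = ε
    swap {m = just z} (bump {ys = ys} q) _   = swapHead ys p q
    swap {m = just z} (pass {zs = zs} q b) (d ∷ _) = swapHead zs d (DR⇒R q (Push-bumped b))

  Pushes-∼ : ∀ {u v w w′} → Column v → Pushes u v w w′ →
              reverse u ++ reverse v ∼ reverse w ++ reverse w′
  Pushes-∼ {v = v} _ done = ∼-reflexive (sym (++-identityʳ _))
  Pushes-∼ {x ∷ u} {v} {w} {w′} c (plain a q) =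
    ∼-reflexive (trans (cong (_++ _) (unfold-reverse x u)) (++-assoc (reverse u) _ _))
    ◅◅ ∼-++ˡ (reverse u) (Push-∼ c a ◅◅ ∼-reflexive (++-identityʳ _))
    ◅◅ Pushes-∼ (Push-Column c a) q
  Pushes-∼ {x ∷ u} {v} {w} {y ∷ w′} c (emit {v′ = v′} a q) =
    ∼-reflexive (trans (cong (_++ _) (unfold-reverse x u)) (++-assoc (reverse u) _ _))
    ◅◅ ∼-++ˡ (reverse u) (Push-∼ c a)
    ◅◅ ∼-reflexive (sym (++-assoc (reverse u) (reverse v′) _))
    ◅◅ ∼-++ʳ [ y ] (Pushes-∼ (Push-Column c a) q)
    ◅◅ ∼-reflexive (trans (++-assoc (reverse w) _ _)
         (cong (reverse w ++_) (sym (unfold-reverse y w′))))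

  Greedy-∼ : ∀ {u v w w′} → Column u → Column v → Greedy u v w w′ →
              reverse u ++ reverse v ∼ reverse w ++ reverse w′
  Greedy-∼ c d g = Pushes-∼ d (Greedy⇒Pushes c g)

  -- Juxtaposition

  data Jux : List A → List A → Set where
    []  : ∀ {u} → Jux u []
    _∷_ : ∀ {x y u v} → R x y → Jux u v → Jux (x ∷ u) (y ∷ v)

  Jux-length : ∀ {u v} → Jux u v → length v ≤ length u
  Jux-length []      = z≤n
  Jux-length (_ ∷ j) = s≤s (Jux-length j)

  Jux-trans : ∀ {u v w} → Jux u v → Jux v w → Jux u w
  Jux-trans _       []      = []
  Jux-trans (p ∷ i) (q ∷ j) = R-trans p q ∷ Jux-trans i j

  -- Each letter on the right now faces a letter from higher up in the left column, hence a smaller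
  -- one.
  Jux-raise : ∀ {x u v} → Column (x ∷ u) → Jux u v → Jux (x ∷ u) v
  Jux-raise _                []      = []
  Jux-raise ((d ∷ _) ∷ as)   (p ∷ j) = DR⇒R d p ∷ Jux-raise as j

  Jux-drop : ∀ {u y v} → Column (y ∷ v) → Jux u (y ∷ v) → Jux u v
  Jux-drop {v = []}    _              _       = []
  Jux-drop {v = _ ∷ _} ((d ∷ _) ∷ as) (p ∷ j) = RD⇒R p d ∷ Jux-drop as j

  Greedy-Jux : ∀ {u v w w′} → Column u → Column v → Greedy u v w w′ → Jux w w′
  Greedy-Jux _        _        doneˡ         = []
  Greedy-Jux _        _        doneʳ         = []
  Greedy-Jux (_ ∷ as) (_ ∷ bs) (match p g)   = p ∷ Greedy-Jux as bs g
  Greedy-Jux c        d@(_ ∷ bs) g@(skip p h) = Jux-raise (Greedy-Columnˡ c d g) (Greedy-Jux c bs h)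

  Greedy-Juxˡ : ∀ {u v w w′} → Greedy u v w w′ → Jux u w′
  Greedy-Juxˡ doneˡ       = []
  Greedy-Juxˡ doneʳ       = []
  Greedy-Juxˡ (match p g) = p ∷ Greedy-Juxˡ g
  Greedy-Juxˡ (skip _ g)  = Greedy-Juxˡ g

  Greedy-fixed : ∀ {u v w w′} → Jux u v → Greedy u v w w′ → w ≡ u × w′ ≡ v
  Greedy-fixed []      doneˡ = refl , refl
  Greedy-fixed _       doneʳ = refl , refl
  Greedy-fixed (_ ∷ j) (match _ g) with Greedy-fixed j g
  ... | refl , refl = refl , refl
  Greedy-fixed (p ∷ _) (skip q _) = R-D-⊥ p q

  Greedy-merged : ∀ {u v w} → Greedy u v w [] → w ≡ v ++ u
  Greedy-merged doneˡ      = sym (++-identityʳ _)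
  Greedy-merged doneʳ      = refl
  Greedy-merged (skip _ g) = cong (_ ∷_) (Greedy-merged g)

  Greedy-length : ∀ {u v w w′} → Greedy u v w w′ → length w + length w′ ≡ length u + length v
  Greedy-length {v = v} doneˡ = ℕ.+-identityʳ (length v)
  Greedy-length doneʳ         = refl
  Greedy-length {x ∷ u} {y ∷ v} {_ ∷ w} {_ ∷ w′} (match _ g) = cong suc
    (trans (ℕ.+-suc (length w) _) (trans (cong suc (Greedy-length g)) (sym (ℕ.+-suc (length u) _))))
  Greedy-length {x ∷ u} {y ∷ v} (skip _ g) =
    cong suc (trans (Greedy-length g) (sym (ℕ.+-suc (length u) _)))

  Greedy-≤ : ∀ {u v w w′} → Greedy u v w w′ → length w′ ≤ length v
  Greedy-≤ doneˡ       = z≤n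
  Greedy-≤ doneʳ       = z≤n
  Greedy-≤ (match _ g) = s≤s (Greedy-≤ g)
  Greedy-≤ (skip _ g)  = ℕ.m≤n⇒m≤1+n (Greedy-≤ g)

  -- Were every letter of `v` matched, each would be matched in its own row, and the columns would
  -- be juxtaposed.
  Greedy-< : ∀ {u v w w′} → ¬ Jux u v → Greedy u v w w′ → length w′ < length v
  Greedy-< {v = []}    n _           = ⊥-elim (n [])
  Greedy-< {v = _ ∷ _} n doneˡ       = s≤s z≤n
  Greedy-< {v = _ ∷ _} n (match p g) = s≤s (Greedy-< (λ j → n (p ∷ j)) g)
  Greedy-< {v = _ ∷ _} n (skip _ g)  = s≤s (Greedy-≤ g)

  -- Offering more letters to u only makes the matched ones smaller, position by position.
  Greedy-mono : ∀ {u v v′ w d z} → Column v′ → Jux u v → v ⊆ v′ → Greedy u v′ w d →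
                Jux v z → Jux d z
  Greedy-mono _ _ _ _ [] = []
  Greedy-mono _ () _ doneˡ (_ ∷ _)
  Greedy-mono _ _ () doneʳ (_ ∷ _)
  Greedy-mono (_ ∷ c) (_ ∷ j) (refl ∷ s) (match _ g) (q ∷ k) = q ∷ Greedy-mono c j s g k
  Greedy-mono (a ∷ c) (_ ∷ j) (_ ∷ʳ s)   (match _ g) (q ∷ k) with Sublist.All-resp-⊆ s a
  ... | d ∷ _ = DR⇒R d q ∷ Greedy-mono c j (Sublist.∷ˡ⁻ s) g k
  Greedy-mono _ (p ∷ _) (refl ∷ _) (skip q _) (_ ∷ _) = R-D-⊥ p q
  Greedy-mono (_ ∷ c) j (_ ∷ʳ s) (skip _ g) k = Greedy-mono c j s g k

  -- By itself `e` would match all of `e′`, which is contained in `b`. So the letters `d` taken from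
  -- `b` are, row by row, no larger than those of `e′`, and `e′` is juxtaposed with `b′`.
  Greedy-Jux-right : ∀ {e e′ t b b′ a d} → Column e′ → Column t → Jux e e′ →
                     Greedy e′ t b b′ → Greedy e b a d → Jux d b′
  Greedy-Jux-right c c′ j g h =
    Greedy-mono (Greedy-Columnˡ c c′ g) j (Greedy-⊆ˡ g) h (Greedy-Juxˡ g)

  Push-Jux : ∀ {x v w m z} → Push x v w m → Jux v z → Jux w z
  Push-Jux _          []      = []
  Push-Jux (bump p)   (q ∷ j) = R-trans p q ∷ j
  Push-Jux (pass _ a) (q ∷ j) = q ∷ Push-Jux a j

  -- The bumped `y` cannot pass its old right neighbour, so it lands no lower than `x` did. Its new
  -- left neighbour is `x` or a letter passed by `x`, and either may stand to the left of `y`.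
  Push-Jux₂ : ∀ {x w v y w₁ v₁ m} → Jux w v → Push x w w₁ (just y) → Push y v v₁ m → Jux w₁ v₁
  Push-Jux₂ []      (bump p)   end        = p ∷ []
  Push-Jux₂ []      (pass q a) end        = DR⇒R q (Push-bumped a) ∷ []
  Push-Jux₂ (_ ∷ j) (bump p)   (bump _)   = p ∷ j
  Push-Jux₂ (p ∷ _) (bump _)   (pass q _) = R-D-⊥ p q
  Push-Jux₂ (_ ∷ j) (pass q a) (bump _)   = DR⇒R q (Push-bumped a) ∷ Push-Jux a j
  Push-Jux₂ (p ∷ j) (pass _ a) (pass _ b) = p ∷ Push-Jux₂ j a b

  -- The two columns are updated in lockstep: each letter bumped from the first is pushed into the
  -- second at once, so juxtaposition holds after every letter of `u`.
  Pushes-Jux : ∀ {u w v a a′ d b} → Jux w v → Pushes u w a a′ → Pushes a′ v d b → Jux a d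
  Pushes-Jux j done        done        = j
  Pushes-Jux j (plain a p) q           = Pushes-Jux (Push-Jux a j) p q
  Pushes-Jux j (emit a p)  (plain b q) = Pushes-Jux (Push-Jux₂ j a b) p q
  Pushes-Jux j (emit a p)  (emit b q)  = Pushes-Jux (Push-Jux₂ j a b) p q

  -- The tableau of a sequence of juxtaposed columns

  -- The bumping route of one insertion: the middle index lists the letters entering the successive
  -- rows.
  data Route : List (List A) → List A → List (List A) → Set where
    new  : ∀ {y} → Route [] [ y ] [ [ y ] ]
    stop : ∀ {y ys zs t} → Row y ys zs nothing → Route (ys ∷ t) [ y ] (zs ∷ t)
    next : ∀ {y ys zs z s t t′} → Row y ys zs (just z) → Route t (z ∷ s) t′ →
           Route (ys ∷ t) (y ∷ z ∷ s) (zs ∷ t′)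

  Route⇒insert : ∀ {y s t t′} → Route t (y ∷ s) t′ → insert t y ≡ t′
  Route⇒insert new = refl
  Route⇒insert (stop a) rewrite Row⇒insRow a = refl
  Route⇒insert (next a q) rewrite Row⇒insRow a = cong (_ ∷_) (Route⇒insert q)

  -- Every letter of the route passes the new first entry of its row, so an additional column on the
  -- left does not change the route.
  Route-mergeCol : ∀ {c s t t′} → Jux c s → Route t s t′ → Route (mergeCol c t) s (mergeCol c t′)
  Route-mergeCol (p ∷ _) new        = stop (pass p end)
  Route-mergeCol (p ∷ _) (stop a)   = stop (pass p a)
  Route-mergeCol (p ∷ j) (next a q) = next (pass p a) (Route-mergeCol j q)

  Route-column : ∀ {y c} → Column (y ∷ c) → Route (mergeCol c []) (y ∷ c) (mergeCol (y ∷ c) [])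
  Route-column {c = []}    _              = new
  Route-column {c = _ ∷ _} ((d ∷ _) ∷ as) = next (bump d) (Route-column as)

  -- `columnsTB` is transposition, and here it turns columns into rows. The new letter passes the
  -- columns `cs` and pushes the last column down by one row.
  Route-columns : ∀ {y c} cs → Column (y ∷ c) → All (λ b → Jux b (y ∷ c)) cs →
                  Route (columnsTB (cs ++ [ c ])) (y ∷ c) (columnsTB (cs ++ [ y ∷ c ]))
  Route-columns []       c []       = Route-column c
  Route-columns (_ ∷ cs) c (j ∷ js) = Route-mergeCol j (Route-columns cs c js)

  columnsTB-[] : ∀ cs → columnsTB (cs ++ [ [] ]) ≡ columnsTB cs
  columnsTB-[] []       = refl
  columnsTB-[] (c ∷ cs) = cong (mergeCol c) (columnsTB-[] cs)

  inserts-column : ∀ {c} cs → Column c → All (λ b → Jux b c) cs →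
                   foldl insert (columnsTB cs) (reverse c) ≡ columnsTB (cs ++ [ c ])
  inserts-column {[]} cs _ _ = sym (columnsTB-[] cs)
  inserts-column {y ∷ c} cs q@(_ ∷ as) js = begin
    foldl insert (columnsTB cs) (reverse (y ∷ c))
      ≡⟨ cong (foldl insert (columnsTB cs)) (unfold-reverse y c) ⟩
    foldl insert (columnsTB cs) (reverse c ++ [ y ])
      ≡⟨ foldl-++ insert (columnsTB cs) (reverse c) [ y ] ⟩
    insert (foldl insert (columnsTB cs) (reverse c)) y
      ≡⟨ cong (λ t → insert t y) (inserts-column cs as (All.map (Jux-drop q) js)) ⟩
    insert (columnsTB (cs ++ [ c ])) y
      ≡⟨ Route⇒insert (Route-columns cs q js) ⟩
    columnsTB (cs ++ [ y ∷ c ]) ∎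
    where open ≡-Reasoning

  tableau-snoc : ∀ {c} w cs → Column c → All (λ b → Jux b c) cs → tableau w ≡ columnsTB cs →
                 tableau (w ++ reverse c) ≡ columnsTB (cs ++ [ c ])
  tableau-snoc {c} w cs q js e =
    trans (foldl-++ insert [] w (reverse c))
      (trans (cong (λ t → foldl insert t (reverse c)) e) (inserts-column cs q js))

  tableau-two : ∀ {a b} → Column a → Column b → Jux a b →
                tableau (reverse a ++ reverse b) ≡ columnsTB (a ∷ b ∷ [])
  tableau-two {a} ca cb j =
    tableau-snoc (reverse a) (_ ∷ []) cb (j ∷ []) (tableau-snoc [] [] ca [] refl)

  tableau-three : ∀ {a b c} → Column a → Column b → Column c → Jux a b → Jux b c →
                  tableau (reverse a ++ reverse b ++ reverse c) ≡ columnsTB (a ∷ b ∷ c ∷ [])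
  tableau-three {a} {b} ca cb cc i j =
    trans (cong tableau (sym (++-assoc (reverse a) (reverse b) _)))
      (tableau-snoc (reverse a ++ reverse b) (_ ∷ _ ∷ []) cc
        (Jux-trans i j ∷ j ∷ []) (tableau-two ca cb i))

  -- Recovering the columns from the rows

  consNonempty : List A → List (List A) → List (List A)
  consNonempty []         cs = cs
  consNonempty c@(_ ∷ _)  cs = c ∷ cs

  -- Peeling off columns in this way shows that transposing twice is the identity up to empty
  -- columns. The length bound excludes rows of `t` below the end of `c`, whose entries would slip
  -- to the left.
  columnsTB-mergeCol : ∀ c t → length t ≤ length c →
                       columnsTB (mergeCol c t) ≡ consNonempty c (columnsTB t)
  columnsTB-mergeCol []           []      _ = refl
  columnsTB-mergeCol (x ∷ [])     []      _ = refl
  columnsTB-mergeCol (x ∷ y ∷ c)  []      _ rewrite columnsTB-mergeCol (y ∷ c) [] z≤n = refl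
  columnsTB-mergeCol (x ∷ [])     (_ ∷ []) _ = refl
  columnsTB-mergeCol (x ∷ [])     (_ ∷ _ ∷ _) (s≤s ())
  columnsTB-mergeCol (x ∷ y ∷ c)  (_ ∷ t) (s≤s p) rewrite columnsTB-mergeCol (y ∷ c) t p = refl

  length-mergeCol : ∀ c t → length t ≤ length c → length (mergeCol c t) ≡ length c
  length-mergeCol []      []      _       = refl
  length-mergeCol (_ ∷ c) []      _       = cong suc (length-mergeCol c [] z≤n)
  length-mergeCol (_ ∷ c) (_ ∷ t) (s≤s p) = cong suc (length-mergeCol c t p)

  columnsTB-three : ∀ {a b c} → Jux a b → Jux b c → columnsTB (columnsTB (a ∷ b ∷ c ∷ [])) ≡
                    consNonempty a (consNonempty b (consNonempty c []))
  columnsTB-three {a} {b} {c} i j =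
    trans (columnsTB-mergeCol a _ (subst (_≤ length a) (sym lb) (Jux-length i)))
      (cong (consNonempty a)
        (trans (columnsTB-mergeCol b _ (subst (_≤ length b) (sym lc) (Jux-length j)))
        (cong (consNonempty b) (columnsTB-mergeCol c [] z≤n))))
    where
    lc = length-mergeCol c [] z≤n
    lb = length-mergeCol b _ (subst (_≤ length b) (sym lc) (Jux-length j))

  -- Super columns as generators

  descent : ∀ x y → ltb y x ∨ (eqb y x ∧ ∥ x ∥) ≡ not (r x y)
  descent x y with compare y x
  ... | tri< p _ _ = sym (cong not (≻⇒D p))
  ... | tri> _ _ p = sym (cong not (≺⇒R p))
  ... | tri≈ _ refl _ = sym (trans (cong not (r-diagonal x)) (not-involutive ∥ x ∥))

  T-∧⁻ : ∀ {b c} → T (b ∧ c) → T b × T c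
  T-∧⁻ = Equivalence.to T-∧

  T-∧⁺ : ∀ {b c} → T b → T c → T (b ∧ c)
  T-∧⁺ p q = Equivalence.from T-∧ (p , q)

  T-not⇒≡false : ∀ {b} → T (not b) → b ≡ false
  T-not⇒≡false {false} _ = refl

  superColumn⇒Linked : ∀ w → T (isSuperColumn w) → Linked D w
  superColumn⇒Linked []          _ = []
  superColumn⇒Linked (x ∷ [])    _ = [-]
  superColumn⇒Linked (x ∷ y ∷ w) p =
    T-not⇒≡false (subst T (descent x y) (proj₁ ps)) ∷ superColumn⇒Linked (y ∷ w) (proj₂ ps)
    where ps = T-∧⁻ {ltb y x ∨ (eqb y x ∧ ∥ x ∥)} p

  Linked⇒superColumn : ∀ {w} → Linked D w → T (isSuperColumn w)
  Linked⇒superColumn []      = tt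
  Linked⇒superColumn [-]     = tt
  Linked⇒superColumn {x ∷ y ∷ w} (p ∷ ps) =
    T-∧⁺ {ltb y x ∨ (eqb y x ∧ ∥ x ∥)}
      (subst T (sym (trans (descent x y) (cong not p))) tt) (Linked⇒superColumn ps)

  All-reverse : ∀ {P : A → Set} {w} → All P w → All P (reverse w)
  All-reverse [] = []
  All-reverse {P} {x ∷ w} (p ∷ ps) =
    subst (All P) (sym (unfold-reverse x w)) (All.∷ʳ⁺ (All-reverse ps) p)

  AllPairs-reverse : ∀ {Q : A → A → Set} {w} → AllPairs Q w → AllPairs (λ x y → Q y x) (reverse w)
  AllPairs-reverse [] = []
  AllPairs-reverse {Q} {x ∷ w} (p ∷ ps) =
    subst (AllPairs (λ x y → Q y x)) (sym (unfold-reverse x w))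
      (AllPairs.++⁺ (AllPairs-reverse ps) ([] ∷ []) (All.map (_∷ []) (All-reverse p)))

  top : Col → List A
  top u = reverse (word u)

  top-Column : ∀ u → Column (top u)
  top-Column u = AllPairs-reverse
    (Linked⇒AllPairs D-trans
      (superColumn⇒Linked (word u) (proj₁ (T-∧⁻ {isSuperColumn (word u)} (valid u)))))

  reverse-top : ∀ u → reverse (top u) ≡ word u
  reverse-top u = reverse-involutive (word u)

  col : List A → List Col
  col c = toCols (reverse c)

  toCols-yes : ∀ {w} (p : T (isSuperColumn w ∧ not (null w))) → toCols w ≡ [ mkCol w p ]
  toCols-yes {w} p with T? (isSuperColumn w ∧ not (null w))
  ... | yes q = cong (λ q → [ mkCol w q ]) (T-irrelevant q p)
  ... | no ¬q = ⊥-elim (¬q p)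

  toCols-word : ∀ u → toCols (word u) ≡ [ u ]
  toCols-word u = toCols-yes (valid u)

  col-top : ∀ u → col (top u) ≡ [ u ]
  col-top u = trans (cong toCols (reverse-top u)) (toCols-word u)

  not-null-reverse : ∀ x (c : List A) → T (not (null (reverse (x ∷ c))))
  not-null-reverse x c = subst (T ∘ not ∘ null) (sym (unfold-reverse x c)) (go (reverse c))
    where
    go : ∀ w → T (not (null (w ++ [ x ])))
    go []      = tt
    go (_ ∷ _) = tt

  col-∷ : ∀ {x c} → Column (x ∷ c) → Σ Col λ u → col (x ∷ c) ≡ [ u ] × top u ≡ x ∷ c
  col-∷ {x} {c} q = _ , toCols-yes p , reverse-involutive (x ∷ c)
    where
    p : T (isSuperColumn (reverse (x ∷ c)) ∧ not (null (reverse (x ∷ c))))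
    p = T-∧⁺ (Linked⇒superColumn (AllPairs⇒Linked (AllPairs-reverse q))) (not-null-reverse x c)

  flat-col : ∀ {c} → Column c → flat (col c) ≡ reverse c
  flat-col {[]}    _ = refl
  flat-col {x ∷ c} q with col-∷ q
  ... | u , e , e′ = begin
    flat (col (x ∷ c)) ≡⟨ cong flat e ⟩
    word u ++ []       ≡⟨ ++-identityʳ (word u) ⟩
    word u             ≡⟨ reverse-top u ⟨
    reverse (top u)    ≡⟨ cong reverse e′ ⟩
    reverse (x ∷ c)    ∎
    where open ≡-Reasoning

  rowOK⇒Jux : ∀ u v → T (rowOK u v) → Jux u v
  rowOK⇒Jux u       []      _ = []
  rowOK⇒Jux (x ∷ u) (y ∷ v) p with T-∧⁻ {r x y} p
  ... | q , s = ≡true q ∷ rowOK⇒Jux u v s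
    where
    ≡true : ∀ {b} → T b → b ≡ true
    ≡true {true} _ = refl

  Jux⇒rowOK : ∀ {u v} → Jux u v → T (rowOK u v)
  Jux⇒rowOK {[]}    []      = tt
  Jux⇒rowOK {_ ∷ _} []      = tt
  Jux⇒rowOK         (p ∷ j) = T-∧⁺ (subst T (sym p) tt) (Jux⇒rowOK j)

  juxt⇒Jux : ∀ u v → T (juxt u v) → Jux (top u) (top v)
  juxt⇒Jux u v p = rowOK⇒Jux (top u) (top v) (proj₂ (T-∧⁻ {length (word v) ≤ᵇ length (word u)} p))

  Jux⇒juxt : ∀ u v → Jux (top u) (top v) → T (juxt u v)
  Jux⇒juxt u v j = T-∧⁺
    (ℕ.≤⇒≤ᵇ (subst₂ _≤_ (length-reverse (word v)) (length-reverse (word u)) (Jux-length j)))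
    (Jux⇒rowOK j)

  ¬juxt⇒¬Jux : ∀ u v → T (not (juxt u v)) → ¬ Jux (top u) (top v)
  ¬juxt⇒¬Jux u v p j with juxt u v | Jux⇒juxt u v j
  ... | true | _ = p

  ¬¬juxt⇒Jux : ∀ u v → ¬ T (not (juxt u v)) → Jux (top u) (top v)
  ¬¬juxt⇒Jux u v n with juxt u v in e
  ... | true  = juxt⇒Jux u v (subst T (sym e) tt)
  ... | false = ⊥-elim (n tt)

  -- Normal forms and the right-hand sides of the rules

  nf : List A → List Col
  nf w = concatMap toCols (readings (tableau w))

  concatMap-consNonempty : ∀ c cs → concatMap toCols (map reverse (consNonempty c cs)) ≡
                           col c ++ concatMap toCols (map reverse cs)
  concatMap-consNonempty []      cs = refl
  concatMap-consNonempty (_ ∷ _) cs = refl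

  -- This identifies the targets of the two sides of a 3-cell: each side yields juxtaposed columns
  -- in the class of `w`, and the tableau depends only on that class.
  nf-three : ∀ {a b c w} → Column a → Column b → Column c → Jux a b → Jux b c →
             w ∼ reverse a ++ reverse b ++ reverse c → nf w ≡ col a ++ col b ++ col c
  nf-three {a} {b} {c} {w} ca cb cc i j e = begin
    nf w
      ≡⟨ cong (concatMap toCols ∘ readings) (trans (tableau-∼ e) (tableau-three ca cb cc i j)) ⟩
    concatMap toCols (map reverse (columnsTB (columnsTB (a ∷ b ∷ c ∷ []))))
      ≡⟨ cong (concatMap toCols ∘ map reverse) (columnsTB-three i j) ⟩
    concatMap toCols (map reverse (consNonempty a (consNonempty b (consNonempty c []))))
      ≡⟨ concatMap-consNonempty a _ ⟩
    col a ++ concatMap toCols (map reverse (consNonempty b (consNonempty c [])))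
      ≡⟨ cong (col a ++_) (concatMap-consNonempty b _) ⟩
    col a ++ col b ++ concatMap toCols (map reverse (consNonempty c []))
      ≡⟨ cong (λ s → col a ++ col b ++ s) (trans (concatMap-consNonempty c []) (++-identityʳ _)) ⟩
    col a ++ col b ++ col c ∎
    where open ≡-Reasoning

  readings-two : ∀ {u v w w′ x y} → x ≡ reverse u → y ≡ reverse v → Column u → Column v →
                 Greedy u v w w′ →
                 readings (tableau (x ++ y)) ≡ map reverse (consNonempty w (consNonempty w′ []))
  readings-two {u} {v} {w} {w′} refl refl cu cv g = begin
    readings (tableau (reverse u ++ reverse v))
      ≡⟨ cong readings (trans (tableau-∼ (Greedy-∼ cu cv g))
          (tableau-two (Greedy-Columnˡ cu cv g) (Greedy-Columnʳ cv g) (Greedy-Jux cu cv g))) ⟩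
    map reverse (columnsTB (columnsTB (w ∷ w′ ∷ [])))
      ≡⟨ cong (map reverse) (columnsTB-three (Greedy-Jux cu cv g) []) ⟩
    map reverse (consNonempty w (consNonempty w′ [])) ∎
    where open ≡-Reasoning

  colR₀-two : ∀ {u v w w′ x y} → x ≡ reverse u → y ≡ reverse v → Column u → Column v →
              Greedy u v w w′ → toCols (colR 0 (readings (tableau (x ++ y)))) ≡ col w
  colR₀-two {w = w} {w′} e e′ cu cv g
    rewrite readings-two e e′ cu cv g = go w w′ (Greedy-Jux cu cv g)
    where
    go : ∀ w w′ → Jux w w′ →
         toCols (colR 0 (map reverse (consNonempty w (consNonempty w′ [])))) ≡ col w
    go []      _ [] = refl
    go (_ ∷ _) _ _  = refl

  colR₁-two : ∀ {u v w w′ x y} → x ≡ reverse u → y ≡ reverse v → Column u → Column v →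
              Greedy u v w w′ → toCols (colR 1 (readings (tableau (x ++ y)))) ≡ col w′
  colR₁-two {w = w} {w′} e e′ cu cv g
    rewrite readings-two e e′ cu cv g = go w w′ (Greedy-Jux cu cv g)
    where
    go : ∀ w w′ → Jux w w′ →
         toCols (colR 1 (map reverse (consNonempty w (consNonempty w′ [])))) ≡ col w′
    go []      _       [] = refl
    go (_ ∷ _) []      _  = refl
    go (_ ∷ _) (_ ∷ _) _  = refl

  γ-two : ∀ u v {w w′} → readings (tableau (word u ++ word v)) ≡ w ∷ w′ ∷ [] →
          γ u v ≡ toCols w ++ toCols w′
  γ-two u v e rewrite e = refl

  γ-one : ∀ u v {w} → readings (tableau (word u ++ word v)) ≡ w ∷ [] →
          γ u v ≡ toCols (word u ++ word v)
  γ-one u v e rewrite e = refl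

  word≢[] : ∀ u → word u ≡ [] → ⊥
  word≢[] u e = subst (λ w → T (isSuperColumn w ∧ not (null w))) e (valid u)

  ⊆[] : ∀ {w : List A} → w ⊆ [] → w ≡ []
  ⊆[] [] = refl

  γ-Greedy : ∀ u v {w w′} → Greedy (top u) (top v) w w′ → γ u v ≡ col w ++ col w′
  γ-Greedy u v g =
    go g (readings-two (sym (reverse-top u)) (sym (reverse-top v)) (top-Column u) (top-Column v) g)
    where
    go : ∀ {w w′} → Greedy (top u) (top v) w w′ →
         readings (tableau (word u ++ word v)) ≡ map reverse (consNonempty w (consNonempty w′ [])) →
         γ u v ≡ col w ++ col w′
    go {x ∷ w} {_ ∷ _} g e = γ-two u v e
    -- With a single column `γ` takes its default clause, the word `uv`. No letter was matched, so
    -- the column consists of `v` on top of `u`.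
    go {x ∷ w} {[]}    g e = trans (γ-one u v e) (trans (cong toCols merged) (sym (++-identityʳ _)))
      where
      merged : word u ++ word v ≡ reverse (x ∷ w)
      merged = begin
        word u ++ word v ≡⟨ cong₂ _++_ (reverse-top u) (reverse-top v) ⟨
        reverse (top u) ++ reverse (top v) ≡⟨ reverse-++ (top v) (top u) ⟨
        reverse (top v ++ top u) ≡⟨ cong reverse (Greedy-merged g) ⟨
        reverse (x ∷ w) ∎
        where open ≡-Reasoning
    go {[]} g _ = ⊥-elim (word≢[] u (trans (sym (reverse-top u)) (cong reverse (⊆[] (Greedy-⊆ˡ g)))))

  -- The boundary of the 3-cells

  data Path : List Col → List SStep → List Col → Set where
    nil  : ∀ {a} → Path a [] a
    cons : ∀ {a p b} s → a ≡ srcR s → Path (tgtR s) p b → Path a ((fwd , s) ∷ p) b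

  Path-++ : ∀ {a b c p q} → Path a p b → Path b q c → Path a (p ++ q) c
  Path-++ nil          k = k
  Path-++ (cons s e h) k = cons s e (Path-++ h k)

  gstep-step : ∀ l u v r → ¬ Jux (top u) (top v) → Σ (T (not (juxt u v))) λ p →
               gstep l [ u ] [ v ] r ≡ [ (fwd , rstep l u v r p) ]
  gstep-step l u v r n with T? (not (juxt u v))
  ... | yes p = p , refl
  ... | no ¬p = ⊥-elim (n (¬¬juxt⇒Jux u v ¬p))

  gstep-nj : ∀ l u v r p → gstep l [ u ] [ v ] r ≡ [ (fwd , rstep l u v r p) ]
  gstep-nj l u v r p with T? (not (juxt u v))
  ... | yes q = cong (λ q → [ (fwd , rstep l u v r q) ]) (T-irrelevant q p)
  ... | no ¬p = ⊥-elim (¬p p)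

  step-Path : ∀ l u v r p {w w′} → Greedy (top u) (top v) w w′ →
              Path (l ++ u ∷ v ∷ r) [ (fwd , rstep l u v r p) ] (l ++ col w ++ col w′ ++ r)
  step-Path l u v r p {w} {w′} g = cons _ refl
    (subst (λ b → Path (l ++ γ u v ++ r) [] (l ++ b))
      (trans (cong (_++ r) (γ-Greedy u v g)) (++-assoc (col w) (col w′) r)) nil)

  -- On a juxtaposable pair the step is an identity and the matching changes nothing, so both cases
  -- have the same endpoints.
  gstep-Path-cols : ∀ l u v r {w w′} → Greedy (top u) (top v) w w′ →
                    Path (l ++ u ∷ v ∷ r) (gstep l [ u ] [ v ] r) (l ++ col w ++ col w′ ++ r)
  gstep-Path-cols l u v r {w} {w′} g with T? (not (juxt u v))
  ... | yes p = step-Path l u v r p g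
  ... | no ¬p with Greedy-fixed (¬¬juxt⇒Jux u v ¬p) g
  ...   | e , e′ = subst (λ b → Path (l ++ u ∷ v ∷ r) [] (l ++ b)) (sym eq) nil
    where
    eq : col w ++ col w′ ++ r ≡ u ∷ v ∷ r
    eq = cong₂ (λ a b → a ++ b ++ r) (trans (cong col e) (col-top u)) (trans (cong col e′) (col-top v))

  gstep-Path-∷ : ∀ l r {x x′ y y′ w w′} → Column (x ∷ x′) → Column (y ∷ y′) →
                 Greedy (x ∷ x′) (y ∷ y′) w w′ →
                 Path (l ++ col (x ∷ x′) ++ col (y ∷ y′) ++ r)
                      (gstep l (col (x ∷ x′)) (col (y ∷ y′)) r)
                      (l ++ col w ++ col w′ ++ r)
  gstep-Path-∷ l r {w = w} {w′} cx cy g with col-∷ cx | col-∷ cy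
  ... | u , e , d | v , e′ , d′ rewrite e | e′ =
    gstep-Path-cols l u v r (subst₂ (λ x y → Greedy x y w w′) (sym d) (sym d′) g)

  gstep-Path : ∀ l r {x y w w′} → Column x → Column y → Greedy x y w w′ →
               Path (l ++ col x ++ col y ++ r) (gstep l (col x) (col y) r) (l ++ col w ++ col w′ ++ r)
  gstep-Path l r _ _ doneˡ = nil
  gstep-Path l r {x ∷ x′} c _ doneʳ with col-∷ c
  ... | u , e , _ rewrite e = nil
  gstep-Path l r cx cy g@(match _ _) = gstep-Path-∷ l r cx cy g
  gstep-Path l r cx cy g@(skip _ _)  = gstep-Path-∷ l r cx cy g

  Path-resp : ∀ {a a′ p p′ b b′} → a ≡ a′ → p ≡ p′ → b ≡ b′ → Path a p b → Path a′ p′ b′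
  Path-resp refl refl refl k = k

  Greedy-∼-++ʳ : ∀ {u v w w′} z → Column u → Column v → Greedy u v w w′ →
                 reverse u ++ reverse v ++ z ∼ reverse w ++ reverse w′ ++ z
  Greedy-∼-++ʳ {u} {v} {w} {w′} z cu cv g =
    ∼-reflexive (sym (++-assoc (reverse u) (reverse v) z))
    ◅◅ ∼-++ʳ z (Greedy-∼ cu cv g)
    ◅◅ ∼-reflexive (++-assoc (reverse w) (reverse w′) z)

  -- The sides of the 3-cell without their first steps, which for an overlap are the two given
  -- rewriting steps.
  Xsrc-tail Xtgt-tail : Col → Col → Col → List SStep
  Xsrc-tail u v t =
    let E  = toCols (colR 0 (readings (tableau (word u ++ word v))))
        E' = toCols (colR 1 (readings (tableau (word u ++ word v))))
        B  = toCols (colR 0 (readings (tableau (flat E' ++ word t))))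
        B' = toCols (colR 1 (readings (tableau (flat E' ++ word t))))
    in gstep E E' [ t ] [] ++ gstep [] E B B'
  Xtgt-tail u v t =
    let W  = toCols (colR 0 (readings (tableau (word v ++ word t))))
        W' = toCols (colR 1 (readings (tableau (word v ++ word t))))
        Ac = toCols (colR 0 (readings (tableau (word u ++ flat W))))
        A' = toCols (colR 1 (readings (tableau (word u ++ flat W))))
    in gstep [] [ u ] W W' ++ gstep Ac A' W' []

  Xsrc-tail-Path : ∀ u v t → Path (γ u v ++ [ t ]) (Xsrc-tail u v t) (nf (word u ++ word v ++ word t))
  Xsrc-tail-Path u v t with greedy (top u) (top v)
  ... | e , e′ , g with greedy e′ (top t)
  ...   | b , b′ , h with greedy e b
  ...     | a , d , k
    rewrite colR₀-two (sym (reverse-top u)) (sym (reverse-top v)) (top-Column u) (top-Column v) g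
          | colR₁-two (sym (reverse-top u)) (sym (reverse-top v)) (top-Column u) (top-Column v) g
          | colR₀-two (flat-col (Greedy-Columnʳ (top-Column v) g)) (sym (reverse-top t))
              (Greedy-Columnʳ (top-Column v) g) (top-Column t) h
          | colR₁-two (flat-col (Greedy-Columnʳ (top-Column v) g)) (sym (reverse-top t))
              (Greedy-Columnʳ (top-Column v) g) (top-Column t) h =
    Path-resp refl refl (sym final) (Path-++
      (Path-resp
        (trans (cong (λ s → col e ++ col e′ ++ s ++ []) (col-top t))
          (trans (sym (++-assoc (col e) (col e′) [ t ])) (cong (_++ [ t ]) (sym (γ-Greedy u v g)))))
        (cong (λ s → gstep (col e) (col e′) s []) (col-top t))
        (cong (λ s → col e ++ col b ++ s) (++-identityʳ (col b′)))
        (gstep-Path (col e) [] ce′ ct h))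
      (gstep-Path [] (col b′) ce cb k))
    where
    cu = top-Column u
    cv = top-Column v
    ct = top-Column t
    ce = Greedy-Columnˡ cu cv g
    ce′ = Greedy-Columnʳ cv g
    cb = Greedy-Columnˡ ce′ ct h
    word∼ : word u ++ word v ++ word t ∼ reverse a ++ reverse d ++ reverse b′
    word∼ =
      ∼-reflexive (sym (cong₂ _++_ (reverse-top u) (cong₂ _++_ (reverse-top v) (reverse-top t))))
      ◅◅ Greedy-∼-++ʳ (reverse (top t)) cu cv g
      ◅◅ ∼-++ˡ (reverse e) (Greedy-∼ ce′ ct h)
      ◅◅ Greedy-∼-++ʳ (reverse b′) ce cb k
    final : nf (word u ++ word v ++ word t) ≡ col a ++ col d ++ col b′
    -- The last step juxtaposes `a` and `d`; for `d` and `b′` the monotonicity of the matching is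
    -- needed.
    final = nf-three (Greedy-Columnˡ ce cb k) (Greedy-Columnʳ cb k) (Greedy-Columnʳ ct h)
      (Greedy-Jux ce cb k) (Greedy-Jux-right ce′ ct (Greedy-Jux cu cv g) h k) word∼

  Xtgt-tail-Path : ∀ u v t → Path (u ∷ γ v t) (Xtgt-tail u v t) (nf (word u ++ word v ++ word t))
  Xtgt-tail-Path u v t with greedy (top v) (top t)
  ... | w , w′ , g with greedy (top u) w
  ...   | a , a′ , h with greedy a′ w′
  ...     | d , b′ , k
    rewrite colR₀-two (sym (reverse-top v)) (sym (reverse-top t)) (top-Column v) (top-Column t) g
          | colR₁-two (sym (reverse-top v)) (sym (reverse-top t)) (top-Column v) (top-Column t) g
          | colR₀-two (sym (reverse-top u)) (flat-col (Greedy-Columnˡ (top-Column v) (top-Column t) g))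
              (top-Column u) (Greedy-Columnˡ (top-Column v) (top-Column t) g) h
          | colR₁-two (sym (reverse-top u)) (flat-col (Greedy-Columnˡ (top-Column v) (top-Column t) g))
              (top-Column u) (Greedy-Columnˡ (top-Column v) (top-Column t) g) h =
    Path-resp refl refl (sym final) (Path-++
      (Path-resp
        (cong₂ _++_ (col-top u) (sym (γ-Greedy v t g)))
        (cong (λ s → gstep [] s (col w) (col w′)) (col-top u))
        (cong (λ s → col a ++ col a′ ++ s) (sym (++-identityʳ (col w′))))
        (gstep-Path [] (col w′) cu cw h))
      (Path-resp refl refl (cong (λ s → col a ++ col d ++ s) (++-identityʳ (col b′)))
        (gstep-Path (col a) [] ca′ cw′ k)))
    where
    cu = top-Column u
    cv = top-Column v
    ct = top-Column t
    cw = Greedy-Columnˡ cv ct g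
    cw′ = Greedy-Columnʳ ct g
    ca′ = Greedy-Columnʳ cw h
    word∼ : word u ++ word v ++ word t ∼ reverse a ++ reverse d ++ reverse b′
    word∼ =
      ∼-reflexive (sym (cong₂ _++_ (reverse-top u) (cong₂ _++_ (reverse-top v) (reverse-top t))))
      ◅◅ ∼-++ˡ (reverse (top u)) (Greedy-∼ cv ct g)
      ◅◅ Greedy-∼-++ʳ (reverse w′) cu cw h
      ◅◅ ∼-++ˡ (reverse a) (Greedy-∼ ca′ cw′ k)
    final : nf (word u ++ word v ++ word t) ≡ col a ++ col d ++ col b′
    -- The last step juxtaposes `d` and `b′`; for `a` and `d`, the letters of `u` are inserted into
    -- the juxtaposed columns `w`, `w′`.
    final = nf-three (Greedy-Columnˡ cu cw h) (Greedy-Columnˡ ca′ cw′ k) (Greedy-Columnʳ cw′ k)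
      (Pushes-Jux (Greedy-Jux cv ct g) (Greedy⇒Pushes cu h) (Greedy⇒Pushes ca′ k))
      (Greedy-Jux ca′ cw′ k) word∼

  -- The presented monoid

  flat-γ : ∀ u v → flat (γ u v) ∼ word u ++ word v
  flat-γ u v with greedy (top u) (top v)
  ... | w , w′ , g =
    ∼-reflexive (trans (cong flat (γ-Greedy u v g)) (trans (concatMap-++ word (col w) (col w′))
      (cong₂ _++_ (flat-col (Greedy-Columnˡ cu cv g)) (flat-col (Greedy-Columnʳ cv g)))))
    ◅◅ Eq.symmetric PStep (Greedy-∼ cu cv g)
    ◅◅ ∼-reflexive (cong₂ _++_ (reverse-top u) (reverse-top v))
    where
    cu = top-Column u
    cv = top-Column v

  flat-++₃ : ∀ l m r → flat (l ++ m ++ r) ≡ flat l ++ flat m ++ flat r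
  flat-++₃ l m r = trans (concatMap-++ word l (m ++ r)) (cong (flat l ++_) (concatMap-++ word m r))

  ColStep⇒∼ : ∀ {a b} → ColStep a b → flat a ∼ flat b
  ColStep⇒∼ (rstep l u v r _ , refl , refl) =
    ∼-reflexive (trans (flat-++₃ l (u ∷ v ∷ []) r)
      (cong (λ s → flat l ++ (word u ++ s) ++ flat r) (++-identityʳ (word v))))
    ◅◅ ∼-++ˡ (flat l) (∼-++ʳ (flat r) (Eq.symmetric PStep (flat-γ u v)))
    ◅◅ ∼-reflexive (sym (flat-++₃ l (γ u v) r))

  infix 4 _≃_
  _≃_ : List Col → List Col → Set
  _≃_ = _≡Col₂_

  ≃⇒∼ : ∀ {a b} → a ≃ b → flat a ∼ flat b
  ≃⇒∼ = Eq.gfold (Eq.isEquivalence PStep) flat ColStep⇒∼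

  whiskR : List Col → List Col → RStep → RStep
  whiskR l r (rstep l′ u v r′ p) = rstep (l ++ l′) u v (r′ ++ r) p

  whisk-++ : ∀ (l r l′ m r′ : List Col) → l ++ (l′ ++ m ++ r′) ++ r ≡ (l ++ l′) ++ m ++ r′ ++ r
  whisk-++ l r l′ m r′ = begin
    l ++ (l′ ++ m ++ r′) ++ r ≡⟨ cong (l ++_) (++-assoc l′ (m ++ r′) r) ⟩
    l ++ l′ ++ (m ++ r′) ++ r ≡⟨ cong (λ s → l ++ l′ ++ s) (++-assoc m r′ r) ⟩
    l ++ l′ ++ m ++ r′ ++ r   ≡⟨ ++-assoc l l′ _ ⟨
    (l ++ l′) ++ m ++ r′ ++ r ∎
    where open ≡-Reasoning

  srcR-whisk : ∀ l r s → l ++ srcR s ++ r ≡ srcR (whiskR l r s)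
  srcR-whisk l r (rstep l′ u v r′ _) = whisk-++ l r l′ (u ∷ v ∷ []) r′

  tgtR-whisk : ∀ l r s → l ++ tgtR s ++ r ≡ tgtR (whiskR l r s)
  tgtR-whisk l r (rstep l′ u v r′ _) = whisk-++ l r l′ (γ u v) r′

  ≃-whisk : ∀ l r {a b} → a ≃ b → l ++ a ++ r ≃ l ++ b ++ r
  ≃-whisk l r = Eq.gmap (λ a → l ++ a ++ r) step
    where
    step : ∀ {a b} → ColStep a b → ColStep (l ++ a ++ r) (l ++ b ++ r)
    step (s , refl , refl) = whiskR l r s , srcR-whisk l r s , tgtR-whisk l r s

  ¬Jux⇒nj : ∀ u v → ¬ Jux (top u) (top v) → T (not (juxt u v))
  ¬Jux⇒nj u v n = proj₁ (gstep-step [] u v [] n)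

  γ-≃ : ∀ u v {w w′} → ¬ Jux (top u) (top v) → Greedy (top u) (top v) w w′ →
        u ∷ v ∷ [] ≃ col w ++ col w′
  γ-≃ u v n g = fwd (rstep [] u v [] (¬Jux⇒nj u v n) , refl ,
    trans (sym (γ-Greedy u v g)) (sym (++-identityʳ (γ u v)))) ◅ ε

  single : A → Col
  single x = mkCol [ x ] tt

  Greedy-skips : ∀ {x v} → All (D x) v → Greedy [ x ] v (v ++ [ x ]) []
  Greedy-skips []       = doneʳ
  Greedy-skips (p ∷ ps) = skip p (Greedy-skips ps)

  All-D⇒¬Jux : ∀ {x v} → All (D x) v → v ≢ [] → ¬ Jux [ x ] v
  All-D⇒¬Jux _       n []      = n refl
  All-D⇒¬Jux (p ∷ _) _ (q ∷ _) = R-D-⊥ q p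

  -- The rule for the bottom letter and the rest of the column merges the two; read backwards, it
  -- splits off one letter.
  column-≃ : ∀ w p → [ mkCol w p ] ≃ map single w
  column-≃ (x ∷ [])    p = ε
  column-≃ (x ∷ y ∷ w) p =
    Eq.symmetric ColStep (subst (λ b → single x ∷ v ∷ [] ≃ b) e
      (γ-≃ (single x) v (All-D⇒¬Jux xv λ e → word≢[] v (trans (sym (reverse-top v)) (cong reverse e)))
        (Greedy-skips xv)))
    ◅◅ ≃-whisk [ single x ] [] (column-≃ (y ∷ w) q)
    ◅◅ subst (λ s → single x ∷ s ≃ map single (x ∷ y ∷ w)) (sym (++-identityʳ _)) ε
    where
    q : T (isSuperColumn (y ∷ w) ∧ true)
    q = T-∧⁺ (proj₂ (T-∧⁻ {ltb y x ∨ (eqb y x ∧ ∥ x ∥)}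
          (proj₁ (T-∧⁻ {isSuperColumn (x ∷ y ∷ w)} p)))) tt
    v = mkCol (y ∷ w) q
    xv : All (D x) (top v)
    xv with Linked⇒AllPairs D-trans
            (superColumn⇒Linked (x ∷ y ∷ w) (proj₁ (T-∧⁻ {isSuperColumn (x ∷ y ∷ w)} p)))
    ... | a ∷ _ = All-reverse a
    e : col (top v ++ [ x ]) ++ col [] ≡ [ mkCol (x ∷ y ∷ w) p ]
    e = trans (++-identityʳ _) (trans (cong toCols (trans (reverse-++ (top v) [ x ])
          (cong (x ∷_) (reverse-top v)))) (toCols-word (mkCol (x ∷ y ∷ w) p)))

  letters-≃ : ∀ a → a ≃ map single (flat a)
  letters-≃ []      = ε
  letters-≃ (mkCol w p ∷ a) =
    ≃-whisk [] a (column-≃ w p)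
    ◅◅ subst₂ _≃_ (cong (map single w ++_) (++-identityʳ a))
         (trans (cong (map single w ++_) (++-identityʳ _)) (sym (map-++ single w (flat a))))
         (≃-whisk (map single w) [] (letters-≃ a))

  pair : ∀ x y → D x y → Col
  pair x y p = mkCol (x ∷ y ∷ []) (T-∧⁺ (Linked⇒superColumn (p ∷ [-])) tt)

  pair-≃ : ∀ {x y} (p : D x y) → [ pair x y p ] ≃ single x ∷ single y ∷ []
  pair-≃ p = column-≃ _ _

  -- After two-letter columns are formed, each relation is a single rule: `x · zy` becomes `zx · y`,
  -- and `y · zx` becomes `yx · z`. The pairs are not juxtaposable because the right column is the
  -- longer one.
  Knuth-≃ : ∀ {w w′} → Knuth w w′ → map single w ≃ map single w′
  Knuth-≃ (k₁ {x} {y} {z} p q) =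
    ≃-whisk [] [ single y ] (Eq.symmetric ColStep (pair-≃ zx))
    ◅◅ subst (_≃ single x ∷ pair z y q ∷ []) (cong (_++ [ single y ]) (toCols-word (pair z x zx)))
         (Eq.symmetric ColStep (γ-≃ (single x) (pair z y q) (λ { (_ ∷ ()) }) (match p doneˡ)))
    ◅◅ ≃-whisk [ single x ] [] (pair-≃ q)
    where zx = RD⇒D p q
  Knuth-≃ (k₂ {x} {y} {z} p q) =
    ≃-whisk [ single y ] [] (Eq.symmetric ColStep (pair-≃ zx))
    ◅◅ subst (single y ∷ pair z x zx ∷ [] ≃_) (cong (_++ [ single z ]) (toCols-word (pair y x p)))
         (γ-≃ (single y) (pair z x zx) (λ { (_ ∷ ()) }) (skip p (match q doneˡ)))
    ◅◅ ≃-whisk [] [ single z ] (pair-≃ p)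
    where zx = DR⇒D p q

  PStep⇒≃ : ∀ {w w′} → PStep w w′ → map single w ≃ map single w′
  PStep⇒≃ p with PStep⇒Knuth p
  ... | pre , post , k , k′ , q , refl , refl =
    subst₂ _≃_ (sym (e k)) (sym (e k′)) (≃-whisk (map single pre) (map single post) (Knuth-≃ q))
    where
    e : ∀ k → map single (pre ++ k ++ post) ≡ map single pre ++ map single k ++ map single post
    e k = trans (map-++ single pre (k ++ post)) (cong (map single pre ++_) (map-++ single k post))

  flat-letters : ∀ w → flat (map single w) ≡ w
  flat-letters []      = refl
  flat-letters (x ∷ w) = cong (x ∷_) (flat-letters w)

  presents : PresentsP
  presents =
    (λ a b → ≃⇒∼) ,
    -- Injectivity: both words are split into one-letter columns, where every plactic step lifts.
    (λ a b p → letters-≃ a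
      ◅◅ Eq.gfold (Eq.isEquivalence ColStep) (map single) PStep⇒≃ p
      ◅◅ Eq.symmetric ColStep (letters-≃ b)) ,
    (λ w → map single w , ∼-reflexive (sym (flat-letters w)))

  -- Termination

  size : List Col → ℕ
  size []      = 0
  size (u ∷ a) = length (word u) + size a

  -- Σ i |cᵢ₊₁| decreases because every step moves letters into a column further left.
  μ : List Col → ℕ
  μ []      = 0
  μ (_ ∷ a) = size a + μ a

  col-size : ∀ {c} a → Column c → size (col c ++ a) ≡ length c + size a
  col-size {[]}    a _ = refl
  col-size {x ∷ c} a q with col-∷ q
  ... | u , e , e′ rewrite e =
    cong (_+ size a) (trans (sym (length-reverse (word u))) (cong length e′))

  -- Only an inequality, because an empty column is dropped and everything after it moves one place
  -- to the left.
  col-μ : ∀ c a → Column c → μ (col c ++ a) ≤ size a + μ a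
  col-μ []      a _ = ℕ.m≤n+m (μ a) (size a)
  col-μ (x ∷ c) a q with col-∷ q
  ... | u , e , _ rewrite e = ℕ.≤-refl

  length-top : ∀ u → length (top u) ≡ length (word u)
  length-top u = length-reverse (word u)

  γ-size : ∀ u v r → size (γ u v ++ r) ≡ size (u ∷ v ∷ r)
  γ-size u v r with greedy (top u) (top v)
  ... | w , w′ , g = begin
    size (γ u v ++ r)
      ≡⟨ cong size (trans (cong (_++ r) (γ-Greedy u v g)) (++-assoc (col w) (col w′) r)) ⟩
    size (col w ++ col w′ ++ r)
      ≡⟨ trans (col-size (col w′ ++ r) (Greedy-Columnˡ cu cv g))
           (cong (length w +_) (col-size r (Greedy-Columnʳ cv g))) ⟩
    length w + (length w′ + size r)
      ≡⟨ ℕ.+-assoc (length w) (length w′) (size r) ⟨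
    length w + length w′ + size r
      ≡⟨ cong (_+ size r) (trans (Greedy-length g) (cong₂ _+_ (length-top u) (length-top v))) ⟩
    length (word u) + length (word v) + size r
      ≡⟨ ℕ.+-assoc (length (word u)) (length (word v)) (size r) ⟩
    size (u ∷ v ∷ r) ∎
    where
    open ≡-Reasoning
    cu = top-Column u
    cv = top-Column v

  γ-μ : ∀ u v r → T (not (juxt u v)) → μ (γ u v ++ r) < μ (u ∷ v ∷ r)
  γ-μ u v r p with greedy (top u) (top v)
  ... | w , w′ , g = begin-strict
    μ (γ u v ++ r)
      ≡⟨ cong μ (trans (cong (_++ r) (γ-Greedy u v g)) (++-assoc (col w) (col w′) r)) ⟩
    μ (col w ++ col w′ ++ r)
      ≤⟨ col-μ w (col w′ ++ r) (Greedy-Columnˡ cu cv g) ⟩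
    size (col w′ ++ r) + μ (col w′ ++ r)
      ≤⟨ ℕ.+-mono-≤ (ℕ.≤-reflexive (col-size r (Greedy-Columnʳ cv g)))
           (col-μ w′ r (Greedy-Columnʳ cv g)) ⟩
    length w′ + size r + (size r + μ r)
      <⟨ ℕ.+-monoˡ-< (size r + μ r) (ℕ.+-monoˡ-< (size r)
           (subst (length w′ <_) (length-top v) (Greedy-< (¬juxt⇒¬Jux u v p) g))) ⟩
    length (word v) + size r + (size r + μ r) ∎
    where
    open ℕ.≤-Reasoning
    cu = top-Column u
    cv = top-Column v

  size-++ˡ : ∀ l {a b} → size a ≡ size b → size (l ++ a) ≡ size (l ++ b)
  size-++ˡ []      e = e
  size-++ˡ (u ∷ l) e = cong (length (word u) +_) (size-++ˡ l e)

  -- Each column of `l` contributes the number of letters to its right, hence the condition that the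
  -- sizes agree.
  μ-++ˡ : ∀ l {a b} → size a ≡ size b → μ a < μ b → μ (l ++ a) < μ (l ++ b)
  μ-++ˡ []      _ p = p
  μ-++ˡ (u ∷ l) e p = ℕ.+-mono-≤-< (ℕ.≤-reflexive (size-++ˡ l e)) (μ-++ˡ l e p)

  step-μ : ∀ s → μ (tgtR s) < μ (srcR s)
  step-μ (rstep l u v r p) = μ-++ˡ l (γ-size u v r) (γ-μ u v r p)

  Normal : List Col → Set
  Normal a = ∀ s → a ≢ srcR s

  step⊎normal : ∀ a → (∃[ s ] a ≡ srcR s) ⊎ Normal a
  step⊎normal [] = inj₂ λ { (rstep [] _ _ _ _) () ; (rstep (_ ∷ _) _ _ _ _) () }
  step⊎normal (u ∷ []) =
    inj₂ λ { (rstep [] _ _ _ _) () ; (rstep (_ ∷ []) _ _ _ _) () ; (rstep (_ ∷ _ ∷ _) _ _ _ _) () }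
  step⊎normal (u ∷ a@(v ∷ r)) with T? (not (juxt u v)) | step⊎normal a
  ... | yes p | _ = inj₁ (rstep [] u v r p , refl)
  ... | no _  | inj₁ (rstep l u′ v′ r′ p , e) = inj₁ (rstep (u ∷ l) u′ v′ r′ p , cong (u ∷_) e)
  ... | no ¬p | inj₂ n = inj₂ λ
    { (rstep [] _ _ _ p)       refl → ¬p p
    ; (rstep (_ ∷ l) u′ v′ r′ p) e  → n (rstep l u′ v′ r′ p) (∷-injectiveʳ e) }

  normalise : ∀ a → Acc _<_ (μ a) → ∃₂ λ p b → Path a p b × Normal b
  normalise a (acc h) with step⊎normal a
  ... | inj₂ n          = [] , a , nil , n
  ... | inj₁ (s , refl) with normalise (tgtR s) (h (step-μ s))
  ...   | p , b , k , n = (fwd , s) ∷ p , b , cons s refl k , n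

  -- Homotopies of zigzags

  src-flip : ∀ s → src (flip s) ≡ tgt s
  src-flip (fwd , _) = refl
  src-flip (bwd , _) = refl

  tgt-flip : ∀ s → tgt (flip s) ≡ src s
  tgt-flip (fwd , _) = refl
  tgt-flip (bwd , _) = refl

  Valid-++ : ∀ {a b c} p {q} → Valid a p b → Valid b q c → Valid a (p ++ q) c
  Valid-++ []      refl    w = w
  Valid-++ (s ∷ p) (e , v) w = e , Valid-++ p v w

  Path⇒Valid : ∀ {a p b} → Path a p b → Valid a p b
  Path⇒Valid nil          = refl
  Path⇒Valid (cons s e k) = e , Path⇒Valid k

  ++-nest : ∀ (a b c d e : List SStep) → a ++ (b ++ c ++ d) ++ e ≡ (a ++ b) ++ c ++ d ++ e
  ++-nest a b c d e = begin
    a ++ (b ++ c ++ d) ++ e ≡⟨ cong (a ++_) (++-assoc b (c ++ d) e) ⟩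
    a ++ b ++ (c ++ d) ++ e ≡⟨ cong (λ s → a ++ b ++ s) (++-assoc c d e) ⟩
    a ++ b ++ c ++ d ++ e   ≡⟨ ++-assoc a b _ ⟨
    (a ++ b) ++ c ++ d ++ e ∎
    where open ≡-Reasoning

  Homotopic-++ : ∀ {a b c d pre post p q} → Valid a pre c → Homotopic c d p q → Valid d post b →
                 Homotopic a b (pre ++ p ++ post) (pre ++ q ++ post)
  Homotopic-++ v hrefl        w = hrefl
  Homotopic-++ v (hsym h)     w = hsym (Homotopic-++ v h w)
  Homotopic-++ v (htrans h k) w = htrans (Homotopic-++ v h w) (Homotopic-++ v k w)
  Homotopic-++ {a} {b} {pre = pre} {post} v (hgen pre′ post′ L R x y z) w =
    subst₂ (Homotopic a b) (sym (eq L)) (sym (eq R))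
      (hgen (pre ++ pre′) (post′ ++ post) L R x (valid′ L y) (valid′ R z))
    where
    eq : ∀ M → pre ++ (pre′ ++ M ++ post′) ++ post ≡ (pre ++ pre′) ++ M ++ post′ ++ post
    eq M = ++-nest pre pre′ M post′ post
    valid′ : ∀ M → Valid _ (pre′ ++ M ++ post′) _ → Valid a ((pre ++ pre′) ++ M ++ post′ ++ post) b
    valid′ M u = subst (λ p → Valid a p b) (eq M) (Valid-++ pre v (Valid-++ (pre′ ++ M ++ post′) u w))

  Homotopic-++ʳ : ∀ {a b c p q} post → Homotopic a c p q → Valid c post b →
                  Homotopic a b (p ++ post) (q ++ post)
  Homotopic-++ʳ _ h w = Homotopic-++ {pre = []} refl h w

  Homotopic-∷ : ∀ {a b p q} s → a ≡ src s → Homotopic (tgt s) b p q → Homotopic a b (s ∷ p) (s ∷ q)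
  Homotopic-∷ {p = p} {q} s e h =
    subst₂ (Homotopic _ _) (cong (s ∷_) (++-identityʳ p)) (cong (s ∷_) (++-identityʳ q))
      (Homotopic-++ {pre = [ s ]} {post = []} (e , refl) h refl)

  Homotopic-Elem : ∀ {a b L R} → Elem L R → Valid a L b → Valid a R b → Homotopic a b L R
  Homotopic-Elem {a} {b} {L} {R} x v w =
    subst₂ (Homotopic a b) (++-identityʳ L) (++-identityʳ R)
      (hgen [] [] L R x (subst (λ p → Valid a p b) (sym (++-identityʳ L)) v)
        (subst (λ p → Valid a p b) (sym (++-identityʳ R)) w))

  Homotopic-reflexive : ∀ {a b p q} → p ≡ q → Homotopic a b p q
  Homotopic-reflexive refl = hrefl

  cancel : ∀ {a b p} s → a ≡ src s → Valid a p b → Homotopic a b (s ∷ flip s ∷ p) p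
  cancel {p = p} s refl v =
    Homotopic-++ʳ p
      (Homotopic-Elem (inverse s) (refl , sym (src-flip s) , tgt-flip s) refl) v

  inv : List SStep → List SStep
  inv []      = []
  inv (s ∷ p) = inv p ++ [ flip s ]

  Valid-inv : ∀ {a b} p → Valid a p b → Valid b (inv p) a
  Valid-inv []      refl       = refl
  Valid-inv (s ∷ p) (refl , v) =
    Valid-++ (inv p) (Valid-inv p v) (sym (src-flip s) , tgt-flip s)

  inv-cancel : ∀ {a b} p → Valid a p b → Homotopic a a (p ++ inv p) []
  inv-cancel [] _ = hrefl
  inv-cancel (s ∷ p) (refl , v) =
    htrans (Homotopic-reflexive (cong (s ∷_) (sym (++-assoc p (inv p) [ flip s ]))))
      (htrans (Homotopic-∷ s refl
        (Homotopic-++ʳ [ flip s ] (inv-cancel p v) (sym (src-flip s) , tgt-flip s)))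
        (cancel s refl refl))

  -- Local confluence up to 3-cells

  Joinable : List Col → RStep → RStep → Set
  Joinable a s s′ = ∃[ c ] ∃[ p ] ∃[ p′ ] Path (tgtR s) p c × Path (tgtR s′) p′ c ×
                    Homotopic a c ((fwd , s) ∷ p) ((fwd , s′) ∷ p′)

  Joinable-sym : ∀ {a s s′} → Joinable a s s′ → Joinable a s′ s
  Joinable-sym (c , p , p′ , k , k′ , h) = c , p′ , p , k′ , k , hsym h

  join-disjoint : ∀ l m r u v u′ v′ p p′ →
    Joinable (l ++ u ∷ v ∷ m ++ u′ ∷ v′ ∷ r)
      (rstep l u v (m ++ u′ ∷ v′ ∷ r) p) (rstep (l ++ u ∷ v ∷ m) u′ v′ r p′)
  join-disjoint l m r u v u′ v′ p p′ =
    l ++ γ u v ++ m ++ γ u′ v′ ++ r , [ fwd , s₁ ] , [ fwd , s₂ ] , k , k′ ,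
    Homotopic-Elem (exchange l m r u v u′ v′ p p′)
      (refl , Path⇒Valid k)
      (sym (++-assoc l (u ∷ v ∷ m) _) , Path⇒Valid k′)
    where
    s₁ = rstep (l ++ γ u v ++ m) u′ v′ r p′
    s₂ = rstep l u v (m ++ γ u′ v′ ++ r) p
    assoc₃ : ∀ (x y z w : List Col) → x ++ y ++ z ++ w ≡ (x ++ y ++ z) ++ w
    assoc₃ x y z w = trans (cong (x ++_) (sym (++-assoc y z w))) (sym (++-assoc x (y ++ z) w))
    k = cons s₁ (assoc₃ l (γ u v) m _) (Path-resp (assoc₃ l (γ u v) m _) refl refl nil)
    k′ = cons s₂ (++-assoc l (u ∷ v ∷ m) _) nil

  Path-whisk : ∀ l r {a p b} → Path a p b → Path (l ++ a ++ r) (whisk l r p) (l ++ b ++ r)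
  Path-whisk l r nil = nil
  Path-whisk l r (cons s refl k) =
    cons (whiskR l r s) (srcR-whisk l r s) (Path-resp (tgtR-whisk l r s) refl refl (Path-whisk l r k))

  -- The two steps are the first steps of the two sides of the whiskered generating 3-cell.
  join-overlapping : ∀ l r u v t p p′ →
    Joinable (l ++ u ∷ v ∷ t ∷ r) (rstep l u v (t ∷ r) p) (rstep (l ++ [ u ]) v t r p′)
  join-overlapping l r u v t p p′ =
    l ++ nf w ++ r , whisk l r (Xsrc-tail u v t) , whisk l r (Xtgt-tail u v t) , k , k′ ,
    Homotopic-Elem (subst₂ Elem eq eq′ (X l r u v t p p′))
      (refl , Path⇒Valid k) (sym (++-assoc l [ u ] _) , Path⇒Valid k′)
    where
    w = word u ++ word v ++ word t
    k = Path-resp (cong (l ++_) (++-assoc (γ u v) [ t ] r)) refl refl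
          (Path-whisk l r (Xsrc-tail-Path u v t))
    k′ = Path-resp (sym (++-assoc l [ u ] _)) refl refl
          (Path-whisk l r (Xtgt-tail-Path u v t))
    eq : whisk l r (Xsrc u v t) ≡ (fwd , rstep l u v (t ∷ r) p) ∷ whisk l r (Xsrc-tail u v t)
    eq = trans (cong (λ s → whisk l r (s ++ Xsrc-tail u v t)) (gstep-nj [] u v [ t ] p))
           (cong (λ l′ → (fwd , rstep l′ u v (t ∷ r) p) ∷ whisk l r (Xsrc-tail u v t)) (++-identityʳ l))
    eq′ : whisk l r (Xtgt u v t) ≡ (fwd , rstep (l ++ [ u ]) v t r p′) ∷ whisk l r (Xtgt-tail u v t)
    eq′ = cong (λ s → whisk l r (s ++ Xtgt-tail u v t)) (gstep-nj [ u ] v t [] p′)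

  -- The length of `k` is the distance between the steps: at distance 0 they coincide, at 1 they
  -- share a column, and from 2 on they are disjoint.
  join-ordered : ∀ l k r u v u′ v′ r′ p p′ → u ∷ v ∷ r ≡ k ++ u′ ∷ v′ ∷ r′ →
                 Joinable (l ++ u ∷ v ∷ r) (rstep l u v r p) (rstep (l ++ k) u′ v′ r′ p′)
  join-ordered l [] r u v u v r p p′ refl
    rewrite ++-identityʳ l | T-irrelevant p p′ = _ , [] , [] , nil , nil , hrefl
  join-ordered l (x ∷ []) r u v v t r′ p p′ refl = join-overlapping l r′ u v t p p′
  join-ordered l (x ∷ y ∷ m) r u v u′ v′ r′ p p′ refl = join-disjoint l m r′ u v u′ v′ p p′

  ++-split : ∀ (l l′ : List Col) {a a′} → l ++ a ≡ l′ ++ a′ →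
             (∃[ k ] l′ ≡ l ++ k × a ≡ k ++ a′) ⊎ (∃[ k ] l ≡ l′ ++ k × a′ ≡ k ++ a)
  ++-split []      l′       e = inj₁ (l′ , refl , e)
  ++-split (x ∷ l) []       e = inj₂ (x ∷ l , refl , sym e)
  ++-split (x ∷ l) (y ∷ l′) e with ∷-injectiveˡ e | ++-split l l′ (∷-injectiveʳ e)
  ... | refl | inj₁ (k , d , d′) = inj₁ (k , cong (x ∷_) d , d′)
  ... | refl | inj₂ (k , d , d′) = inj₂ (k , cong (x ∷_) d , d′)

  join : ∀ {a} s s′ → a ≡ srcR s → a ≡ srcR s′ → Joinable a s s′
  join (rstep l u v r p) (rstep l′ u′ v′ r′ p′) refl e with ++-split l l′ e
  ... | inj₁ (k , refl , d) = join-ordered l k r u v u′ v′ r′ p p′ d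
  ... | inj₂ (k , refl , d) =
    subst (λ a → Joinable a _ _) (sym e) (Joinable-sym (join-ordered l′ k r′ u′ v′ u v r p′ p d))

  -- Squier's argument

  confluence : ∀ {a b c p q} → Acc _<_ (μ a) → Path a p b → Normal b → Path a q c → Normal c →
               b ≡ c × Homotopic a b p q
  confluence _ nil          _ nil          _ = refl , hrefl
  confluence _ nil          n (cons s e _) _ = ⊥-elim (n s e)
  confluence _ (cons s e _) _ nil          n = ⊥-elim (n s e)
  confluence (acc h) (cons s refl k) n (cons s′ e′ k′) n′
    with join s s′ refl e′
  -- As in Newman's lemma, each given path is compared by induction with the path through the join
  -- `d`, continued to a normal form.
  ... | d , f , f′ , i , i′ , j with normalise d (<-wellFounded (μ d))
  ...   | g , z , m , o
    with confluence (h (step-μ s)) k n (Path-++ i m) o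
       | confluence (h (subst (λ a → μ (tgtR s′) < μ a) (sym e′) (step-μ s′))) k′ n′ (Path-++ i′ m) o
  ...     | refl , x | refl , y =
    refl , htrans (Homotopic-∷ (fwd , s) refl x)
      (htrans (Homotopic-++ʳ g j (Path⇒Valid m)) (hsym (Homotopic-∷ (fwd , s′) e′ y)))

  -- Induction on the zigzag. After a forward step a normalising path from its target is inserted
  -- and confluence applies; for a backward step, the forward step prefixed to `q` is a normalising
  -- path for the rest, and the two steps cancel.
  contract : ∀ {a b c d q} p {n} → Valid a p b → Path b n c → Normal c → Path a q d → Normal d →
             c ≡ d × Homotopic a c (p ++ n) q
  contract [] refl k o k′ o′ = confluence (<-wellFounded _) k o k′ o′
  contract ((fwd , s) ∷ p) (refl , v) k o k′ o′
    with normalise (tgtR s) (<-wellFounded _)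
  ... | m , z , i , o″ with contract p v k o i o″ |
                                   confluence (<-wellFounded _) (cons s refl i) o″ k′ o′
  ...   | refl , x | refl , y = refl , htrans (Homotopic-∷ (fwd , s) refl x) y
  contract ((bwd , s) ∷ p) (refl , v) k o k′ o′
    with contract p v k o (cons s refl k′) o′
  ... | refl , x = refl , htrans (Homotopic-∷ (bwd , s) refl x) (cancel (bwd , s) refl (Path⇒Valid k′))

  -- Followed by the normalising path `n` of `b`, both zigzags contract to the normalising path `m`
  -- of `a`; then `n` is cancelled against its inverse.
  homotopyBasis : IsHomotopyBasis
  homotopyBasis a b p q v w
    with normalise a (<-wellFounded _) | normalise b (<-wellFounded _)
  ... | m , c , i , o | n , d , j , o′
    with contract p v j o′ i o | contract q w j o′ i o
  ... | refl , x | _ , y =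
    htrans (hsym (extend p v))
      (htrans (Homotopic-++ʳ (inv n) (htrans x (hsym y)) (Valid-inv n (Path⇒Valid j)))
      (extend q w))
    where
    extend : ∀ p → Valid a p b → Homotopic a b ((p ++ n) ++ inv n) p
    extend p v = htrans (Homotopic-reflexive (++-assoc p n (inv n)))
      (htrans (Homotopic-reflexive (cong (p ++_) (sym (++-identityʳ _))))
        (htrans (Homotopic-++ v (inv-cancel n (Path⇒Valid j)) refl)
          (Homotopic-reflexive (++-identityʳ p))))

theorem3p1 : (S : SignedAlphabet) → Super.IsCoherentPresentationOfP S
theorem3p1 S = SuperPlactic.presents S , SuperPlactic.homotopyBasis S
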